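{- Let $d$ be an even positive integer, and let $H_d(k)$ denote the number of $d\times d$ magic squares with linear sums equal to $k$. Then $$\sum_{m=0}^{N}(-1)^{N+m}\binom{d^2-2d+3}{N-m}H_d(dm)=0,$$ where $N:=\lceil (d-1)^2/2\rceil$.
   Context: A magic square with linear sums $k$ is a $d\times d$ matrix of non-negative integers all of whose row sums and column sums equal $k$ (no condition on diagonals). -}

module Defs where

open import Data.Fin.Base using (Fin; zero; suc)
open import Data.List.Base using (List; []; _∷_; [_]; length; lookup; filter; upTo; cartesianProductWith)
open import Data.List.Membership.Propositional using (_∈_)
open import Data.List.Membership.Propositional.Properties
  using (∈-cartesianProductWith⁺; ∈-filter⁺; ∈-filter⁻; ∈-upTo⁺; ∈-lookup)
open import Data.List.Relation.Unary.All as ListAll using ([]; _∷_)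
open import Data.List.Relation.Unary.AllPairs using ([]; _∷_)
open import Data.List.Relation.Unary.Any using (here; index)
open import Data.List.Relation.Unary.Any.Properties using (lookup-index)
open import Data.List.Relation.Unary.Unique.Propositional using (Unique)
open import Data.List.Relation.Unary.Unique.Propositional.Properties
  using (cartesianProductWith⁺; filter⁺; upTo⁺)
open import Data.Nat.Base using (ℕ; zero; suc; _≤_; s≤s)
open import Data.Nat.Properties using (_≟_; ≡-irrelevant; ≤-reflexive; m+n≤o⇒m≤o; m+n≤o⇒n≤o)
open import Data.Product.Base using (Σ; _×_; _,_; proj₁; proj₂)
open import Data.Vec.Base as Vec using (Vec; []; _∷_; transpose)
open import Data.Vec.Properties using (∷-injective)
open import Data.Vec.Relation.Unary.All as All using (All; []; _∷_; all?)
open import Function.Bundles using (_↔_; mk↔ₛ′)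
open import Relation.Binary.PropositionalEquality
  using (_≡_; refl; sym; trans; cong; cong₂; subst)
open import Relation.Nullary using (Dec; contradiction)
open import Relation.Nullary.Decidable using (_×-dec_)

SquareMatrix : ℕ → Set
SquareMatrix d = Vec (Vec ℕ d) d

IsMagic : ∀ {d} → ℕ → SquareMatrix d → Set
IsMagic k M = All (λ row → Vec.sum row ≡ k) M
            × All (λ col → Vec.sum col ≡ k) (transpose M)

MagicSquare : ℕ → ℕ → Set
MagicSquare d k = Σ (SquareMatrix d) (IsMagic k)

isMagic? : ∀ {d} k (M : SquareMatrix d) → Dec (IsMagic k M)
isMagic? k M = all? (λ row → Vec.sum row ≟ k) M
         ×-dec all? (λ col → Vec.sum col ≟ k) (transpose M)

vectorsOver : ∀ {A : Set} → List A → ∀ n → List (Vec A n)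
vectorsOver xs zero    = [ [] ]
vectorsOver xs (suc n) = cartesianProductWith _∷_ xs (vectorsOver xs n)

-- Entries of a magic square are non-negative, so none exceeds the row sum k:
-- searching the matrices with entries in {0,…,k} misses nothing.
magicSquares : ∀ d k → List (SquareMatrix d)
magicSquares d k = filter (isMagic? k) (vectorsOver (vectorsOver (upTo (suc k)) d) d)

-- The number of d × d magic squares with linear sums k; `H-counts` below
-- shows that this is the cardinality of `MagicSquare d k`.
H : ℕ → ℕ → ℕ
H d k = length (magicSquares d k)

private

  IsMagic-irrelevant : ∀ {d k} {M : SquareMatrix d} (p q : IsMagic k M) → p ≡ q
  IsMagic-irrelevant (p , p′) (q , q′) =
    cong₂ _,_ (All.irrelevant ≡-irrelevant p q) (All.irrelevant ≡-irrelevant p′ q′)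

  vectorsOver-unique : ∀ {A : Set} {xs : List A} → Unique xs → ∀ n → Unique (vectorsOver xs n)
  vectorsOver-unique u zero    = [] ∷ []
  vectorsOver-unique u (suc n) =
    cartesianProductWith⁺ _∷_ ∷-injective u (vectorsOver-unique u n)

  ∈-vectorsOver : ∀ {A : Set} {xs : List A} {n} {v : Vec A n} →
                  All (_∈ xs) v → v ∈ vectorsOver xs n
  ∈-vectorsOver []       = here refl
  ∈-vectorsOver (p ∷ ps) = ∈-cartesianProductWith⁺ _∷_ p (∈-vectorsOver ps)

  entries≤sum : ∀ {n k} (v : Vec ℕ n) → Vec.sum v ≤ k → All (_≤ k) v
  entries≤sum []       _ = []
  entries≤sum (x ∷ v) le = m+n≤o⇒m≤o x le ∷ entries≤sum v (m+n≤o⇒n≤o x le)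

  magicSquares-unique : ∀ d k → Unique (magicSquares d k)
  magicSquares-unique d k =
    filter⁺ (isMagic? k) (vectorsOver-unique (vectorsOver-unique (upTo⁺ (suc k)) d) d)

  ∈-magicSquares⁺ : ∀ {d k} {M : SquareMatrix d} → IsMagic k M → M ∈ magicSquares d k
  ∈-magicSquares⁺ {k = k} magic@(rows , _) =
    ∈-filter⁺ (isMagic? k) (∈-vectorsOver (All.map row∈ rows)) magic
    where
    row∈ : ∀ {n} {row : Vec ℕ n} → Vec.sum row ≡ k → row ∈ vectorsOver (upTo (suc k)) n
    row∈ {row = row} eq =
      ∈-vectorsOver (All.map (λ x≤k → ∈-upTo⁺ (s≤s x≤k)) (entries≤sum row (≤-reflexive eq)))

  ∈-magicSquares⁻ : ∀ {d k} {M : SquareMatrix d} → M ∈ magicSquares d k → IsMagic k M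
  ∈-magicSquares⁻ {d} {k} M∈ =
    proj₂ (∈-filter⁻ (isMagic? k) {xs = vectorsOver (vectorsOver (upTo (suc k)) d) d} M∈)

  lookup-injective : ∀ {A : Set} {xs : List A} → Unique xs →
                     ∀ i j → lookup xs i ≡ lookup xs j → i ≡ j
  lookup-injective (_   ∷ _) zero    zero    _  = refl
  lookup-injective (x∉  ∷ _) zero    (suc j) eq = contradiction eq (ListAll.lookup x∉ (∈-lookup j))
  lookup-injective (x∉  ∷ _) (suc i) zero    eq = contradiction (sym eq) (ListAll.lookup x∉ (∈-lookup i))
  lookup-injective (_   ∷ u) (suc i) (suc j) eq = cong suc (lookup-injective u i j eq)

H-counts : ∀ d k → Fin (H d k) ↔ MagicSquare d k
H-counts d k = mk↔ₛ′ to from to∘from from∘to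
  where
  to : Fin (H d k) → MagicSquare d k
  to i = lookup (magicSquares d k) i , ∈-magicSquares⁻ (∈-lookup i)

  from : MagicSquare d k → Fin (H d k)
  from (M , magic) = index (∈-magicSquares⁺ magic)

  Σ-≡ : {S T : MagicSquare d k} → proj₁ S ≡ proj₁ T → S ≡ T
  Σ-≡ {M , p} {_ , q} refl = cong (M ,_) (IsMagic-irrelevant p q)

  to∘from : ∀ S → to (from S) ≡ S
  to∘from (M , magic) = Σ-≡ (sym (lookup-index (∈-magicSquares⁺ magic)))

  from∘to : ∀ i → from (to i) ≡ i
  from∘to i = lookup-injective (magicSquares-unique d k) (from (to i)) i
                (cong proj₁ (to∘from (to i)))

{-# OPTIONS --safe #-}
-- H_d is a polynomial of degree D = (d-1)² with H_d(-d-k) = (-1)^D H_d(k).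
-- To see this, attach to the cells of the square infinitesimals ε that form a
-- generic magic square (ordered lexicographically as integer vectors), and
-- consider the integer magic squares x with x + ε > 0 in every cell. Choose a
-- permutation matrix π in the support (Birkhoff) and subtract from x + ε the
-- multiple of π that annihilates its minimum over π. The cell attaining the
-- minimum sorts the x into pieces, each the product of a ray and a region of
-- the same kind of one dimension less. Iterating yields half-open unimodular
-- cones with generating functions tᵃ/(1-t)ⁿ, n = D + 1, and reversing the sign
-- of ε turns each of these into tⁿ⁻ᵃ/(1-t)ⁿ. Positive ε give the nonnegative
-- squares and negative ε the positive ones, which are the translates of the
-- former by the all-ones square of line sum d: this is the reciprocity.
--
-- For even d, f(m) = H_d(dm) therefore satisfies f(-1-m) = -f(m), so the
-- (D+2)-th difference of f centred at -1/2, which is zero, consists of two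
-- equal halves. Each half is the sum in question.
module Submission where

open import Defs
open import Data.Nat.Base as ℕ using (ℕ; zero; suc; NonZero; _+_; _∸_; _*_; _^_; ⌈_/2⌉)
open import Data.Nat.Combinatorics using (_C_; nCn≡1; nCk+nC[k+1]≡[n+1]C[k+1]; k>n⇒nCk≡0; nCk≡nC[n∸k])
open import Data.Nat.Divisibility using (_∣_; divides)
open import Data.Fin.Base as Fin
  using (Fin; zero; suc; toℕ; fromℕ; opposite; _↑ˡ_; _↑ʳ_; splitAt; join; combine; remQuot; punchIn; punchOut; finToFun; funToFin)
open import Data.Integer.Base as ℤ using (ℤ; +_; -[1+_]; 0ℤ; 1ℤ; -1ℤ)
open import Data.Integer.Properties using (+-*-semiring)
open import Algebra.Properties.Semiring.Sum +-*-semiring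
  using ( sum; sum⁺-syntax; ∑-comm; ∑-distrib-+; *-distribˡ-sum; *-distribʳ-sum; sum-cong-≗; sum-remove; sum-permute
        ; sum-init-last; sum-replicate-zero)
open import Relation.Binary.PropositionalEquality
  using (_≡_; _≢_; _≗_; refl; sym; trans; cong; cong₂; subst; subst₂; module ≡-Reasoning)

import Algebra.Properties.Semiring.Sum
open import Data.Empty using (⊥; ⊥-elim)
open import Data.Fin.Permutation using (reverse)
import Data.Fin.Properties as Fin
open import Data.Fin.Subset as Subset using (Subset; _∈_; _∪_; ⁅_⁆)
import Data.Fin.Subset.Properties as Subset
import Data.Integer.Properties as ℤ
open import Data.Integer.Tactic.RingSolver using (solve-∀)
open import Data.List.Base as List using (List; []; _∷_)
import Data.List.Properties as List
open import Data.List.Relation.Unary.All as All using (All; []; _∷_)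
import Data.List.Relation.Unary.All.Properties as All
import Data.Nat.Properties as ℕ
import Data.Nat.Tactic.RingSolver as ℕSolver
open import Data.Product.Base using (∃; _×_; _,_; proj₁; proj₂)
open import Data.Sign.Base as Sign using (Sign)
open import Data.Sum.Base using (_⊎_; inj₁; inj₂; [_,_]′)
open import Data.Vec.Base as Vec using (Vec; []; _∷_; transpose)
open import Data.Vec.Functional using (removeAt; insertAt; updateAt)
open import Data.Vec.Functional.Properties
  using (insertAt-lookup; insertAt-punchIn; updateAt-updates; updateAt-minimal)
import Data.Vec.Properties as Vec
import Data.Vec.Relation.Unary.All as VecAll
import Data.Vec.Relation.Unary.All.Properties as VecAll
open import Function.Base using (_∘_; const)
open import Function.Bundles using (Inverse)
open import Function.Definitions using (Injective)
open import Relation.Binary.Definitions using (tri<; tri≈; tri>)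
open import Relation.Nullary using (Dec; yes; no; ¬_; contradiction)
open import Relation.Nullary.Decidable using (_→-dec_; _×-dec_; ¬?; map′)

-- The perturbation settles two matters at once. Without it the minimum over π may be attained at
-- several cells, and the pieces would overlap; moreover the infinitesimal at the minimal cell
-- decides whether a ray begins at 0 or at π. Neither π nor the list of pieces depends on the sign
-- put in front of ε, so one tree of choices serves both signs.
--
-- The recursion stays within integer vectors: subtraction along π moves all infinitesimals into a
-- hyperplane, on which the last coordinate occurring in its equation is redundant for the
-- lexicographic order. Linear relations are stated up to a nonzero integer factor, in place of
-- rational coefficients.
--
-- The coefficient of tᵏ in tᵃ/(1-t)ⁿ agrees with a polynomial for all k ≥ 0 only if a < n; this
-- bound comes from the absence of the origin among the positive squares.
--
-- The difference of order D + 1 already kills f, but D is odd when d is even, and symmetry about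
-- -1/2 demands an even number of terms, hence an odd order: D + 2 = d² - 2d + 3 = 2N + 1.

private module ∑ℕ = Algebra.Properties.Semiring.Sum ℕ.+-*-semiring

-- Cardinalities of finite sets of integer vectors

module Cardinality {E : Set} where

  -- Vectors are compared pointwise, since functional extensionality is not assumed; this is why
  -- translated predicates have to satisfy `Respects`.
  record Card (P : (E → ℤ) → Set) (n : ℕ) : Set where
    field
      elem     : Fin n → E → ℤ
      sound    : ∀ i → P (elem i)
      distinct : ∀ {i j} → elem i ≗ elem j → i ≡ j
      complete : ∀ {x} → P x → ∃ λ i → x ≗ elem i

  open Card

  Respects : ((E → ℤ) → Set) → Set
  Respects P = ∀ {x y} → x ≗ y → P x → P y

  card-cong : ∀ {P Q n} → (∀ {x} → P x → Q x) → (∀ {x} → Q x → P x) → Card P n → Card Q n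
  card-cong to from c = record
    { elem = elem c ; sound = to ∘ sound c ; distinct = distinct c ; complete = complete c ∘ from }

  card-empty : ∀ {P} → (∀ {x} → ¬ P x) → Card P 0
  card-empty ¬p = record
    { elem = λ () ; sound = λ () ; distinct = λ { {()} } ; complete = λ p → contradiction p ¬p }

  card-singleton : ∀ {P x} → P x → (∀ {y} → P y → y ≗ x) → Card P 1
  card-singleton {x = x} p u = record
    { elem = λ _ → x ; sound = λ _ → p ; distinct = λ { {zero} {zero} _ → refl }
    ; complete = λ q → zero , u q }

  card-⊎ : ∀ {P Q m n} → (∀ {x y} → P x → Q y → x ≗ y → ⊥) → Card P m → Card Q n →
           Card (λ x → P x ⊎ Q x) (m ℕ.+ n)
  card-⊎ {P} {Q} {m} {n} disjoint c d = record
    { elem = el ∘ splitAt m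
    ; sound = λ i → snd (splitAt m i)
    ; distinct = λ {i} {j} eq → trans (sym (Fin.join-splitAt m n i))
                   (trans (cong (join m n) (dst (splitAt m i) (splitAt m j) eq)) (Fin.join-splitAt m n j))
    ; complete = λ { (inj₁ p) → let (i , eq) = complete c p in
                       join m n (inj₁ i) , λ f → trans (eq f) (cong (λ z → el z f) (sym (Fin.splitAt-join m n (inj₁ i))))
                   ; (inj₂ q) → let (i , eq) = complete d q in
                       join m n (inj₂ i) , λ f → trans (eq f) (cong (λ z → el z f) (sym (Fin.splitAt-join m n (inj₂ i)))) }
    }
    where
    el : Fin m ⊎ Fin n → E → ℤ
    el = [ elem c , elem d ]′
    snd : ∀ z → P (el z) ⊎ Q (el z)
    snd (inj₁ i) = inj₁ (sound c i)
    snd (inj₂ i) = inj₂ (sound d i)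
    dst : ∀ y z → el y ≗ el z → y ≡ z
    dst (inj₁ i) (inj₁ j) eq = cong inj₁ (distinct c eq)
    dst (inj₁ i) (inj₂ j) eq = ⊥-elim (disjoint (sound c i) (sound d j) eq)
    dst (inj₂ i) (inj₁ j) eq = ⊥-elim (disjoint (sound c j) (sound d i) (sym ∘ eq))
    dst (inj₂ i) (inj₂ j) eq = cong inj₂ (distinct d eq)

  private
    add-sub : ∀ a b → a ℤ.+ b ℤ.- b ≡ a
    add-sub = solve-∀
    sub-add : ∀ a b → a ℤ.- b ℤ.+ b ≡ a
    sub-add = solve-∀

  card-translate : ∀ {P n} (v : E → ℤ) → Respects P → Card P n →
                   Card (λ x → P (λ f → x f ℤ.- v f)) n
  card-translate {P} v resp c = record
    { elem = λ i f → elem c i f ℤ.+ v f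
    ; sound = λ i → resp (λ f → sym (add-sub (elem c i f) (v f))) (sound c i)
    ; distinct = λ {i} {j} eq → distinct c (λ f → trans (sym (add-sub (elem c i f) (v f)))
        (trans (cong (ℤ._- v f) (eq f)) (add-sub (elem c j f) (v f))))
    ; complete = λ {x} p → let (i , eq) = complete c p in
        i , λ f → trans (sym (sub-add (x f) (v f))) (cong (ℤ._+ v f) (eq f))
    }

  card-unique : ∀ {P m n} → Card P m → Card P n → m ≡ n
  card-unique c d = ℕ.≤-antisym (le c d) (le d c)
    where
    le : ∀ {P m n} → Card P m → Card P n → m ℕ.≤ n
    le c d = Fin.injective⇒≤ {f = λ i → proj₁ (complete d (sound c i))} λ {i} {j} eq →
      distinct c λ f → trans (proj₂ (complete d (sound c i)) f)
        (trans (cong (λ z → elem d z f) eq) (sym (proj₂ (complete d (sound c j)) f)))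

-- The lexicographic order on integer vectors

module Lex where

  Zero : ∀ {n} → (Fin n → ℤ) → Set
  Zero v = ∀ i → v i ≡ 0ℤ

  data Pos : ∀ {n} → (Fin n → ℤ) → Set where
    here  : ∀ {n} {v : Fin (suc n) → ℤ} → 0ℤ ℤ.< v zero → Pos v
    there : ∀ {n} {v : Fin (suc n) → ℤ} → v zero ≡ 0ℤ → Pos (v ∘ suc) → Pos v

  NonNeg : ∀ {n} → (Fin n → ℤ) → Set
  NonNeg v = Pos v ⊎ Zero v

  zero? : ∀ {n} (v : Fin n → ℤ) → Dec (Zero v)
  zero? v = Fin.all? (λ i → v i ℤ.≟ 0ℤ)

  pos-cong : ∀ {n} {u v : Fin n → ℤ} → u ≗ v → Pos u → Pos v
  pos-cong eq (here p)       = here (subst (0ℤ ℤ.<_) (eq zero) p)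
  pos-cong eq (there z p) = there (trans (sym (eq zero)) z) (pos-cong (eq ∘ suc) p)

  pos⇒¬zero : ∀ {n} {v : Fin n → ℤ} → Pos v → ¬ Zero v
  pos⇒¬zero (here p)    z = ℤ.<-irrefl (sym (z zero)) p
  pos⇒¬zero (there _ p) z = pos⇒¬zero p (z ∘ suc)

  nonNeg-cong : ∀ {n} {u v : Fin n → ℤ} → u ≗ v → NonNeg u → NonNeg v
  nonNeg-cong eq (inj₁ p) = inj₁ (pos-cong eq p)
  nonNeg-cong eq (inj₂ z) = inj₂ (λ i → trans (sym (eq i)) (z i))

  nonNeg-head : ∀ {n} {v : Fin (suc n) → ℤ} → NonNeg v → 0ℤ ℤ.≤ v zero
  nonNeg-head (inj₁ (here p))    = ℤ.<⇒≤ p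
  nonNeg-head (inj₁ (there z _)) = ℤ.≤-reflexive (sym z)
  nonNeg-head (inj₂ z)           = ℤ.≤-reflexive (sym (z zero))

  pos-+ : ∀ {n} {u v : Fin n → ℤ} → Pos u → NonNeg v → Pos (λ i → u i ℤ.+ v i)
  pos-+ (here p)    q                  = here (ℤ.+-mono-<-≤ p (nonNeg-head q))
  pos-+ (there z p) (inj₁ (here q))    = here (ℤ.+-mono-≤-< (ℤ.≤-reflexive (sym z)) q)
  pos-+ (there z p) (inj₁ (there w q)) = there (cong₂ ℤ._+_ z w) (pos-+ p (inj₁ q))
  pos-+ (there z p) (inj₂ q)           = there (cong₂ ℤ._+_ z (q zero)) (pos-+ p (inj₂ (q ∘ suc)))

  pos-asym : ∀ {n} {v : Fin n → ℤ} → Pos v → ¬ Pos (λ i → ℤ.- v i)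
  pos-asym {v = v} p q = pos⇒¬zero (pos-+ p (inj₁ q)) (λ i → ℤ.+-inverseʳ (v i))

  trichotomy : ∀ {n} (v : Fin n → ℤ) → Pos v ⊎ Zero v ⊎ Pos (λ i → ℤ.- v i)
  trichotomy {zero}  v = inj₂ (inj₁ λ ())
  trichotomy {suc n} v with ℤ.<-cmp 0ℤ (v zero)
  ... | tri< p _ _ = inj₁ (here p)
  ... | tri> _ _ p = inj₂ (inj₂ (here (ℤ.neg-mono-< p)))
  ... | tri≈ _ z _ with trichotomy (v ∘ suc)
  ...   | inj₁ p        = inj₁ (there (sym z) p)
  ...   | inj₂ (inj₁ q) = inj₂ (inj₁ λ { zero → sym z ; (suc i) → q i })
  ...   | inj₂ (inj₂ p) = inj₂ (inj₂ (there (cong ℤ.-_ (sym z)) p))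

  infixl 7 _·_
  _·_ : ∀ {n} → (Fin n → ℤ) → (Fin n → ℤ) → ℤ
  c · v = sum (λ i → c i ℤ.* v i)

  private
    interchange : ∀ c p u q v → c ℤ.* (p ℤ.* u ℤ.+ q ℤ.* v) ≡ p ℤ.* (c ℤ.* u) ℤ.+ q ℤ.* (c ℤ.* v)
    interchange = solve-∀

  ·-zeroʳ : ∀ {n} (c : Fin n → ℤ) {v} → Zero v → c · v ≡ 0ℤ
  ·-zeroʳ {n} c z = trans (sum-cong-≗ λ i → trans (cong (c i ℤ.*_) (z i)) (ℤ.*-zeroʳ (c i))) (sum-replicate-zero n)

  ·-comm : ∀ {n} (u v : Fin n → ℤ) → u · v ≡ v · u
  ·-comm u v = sum-cong-≗ λ i → ℤ.*-comm (u i) (v i)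

  ·-zeroˡ : ∀ {n} {c : Fin n → ℤ} v → Zero c → c · v ≡ 0ℤ
  ·-zeroˡ {c = c} v z = trans (·-comm c v) (·-zeroʳ v z)

  ·-linearʳ : ∀ {n} (c : Fin n → ℤ) p u q v →
              c · (λ i → p ℤ.* u i ℤ.+ q ℤ.* v i) ≡ p ℤ.* (c · u) ℤ.+ q ℤ.* (c · v)
  ·-linearʳ c p u q v = begin
    sum (λ i → c i ℤ.* (p ℤ.* u i ℤ.+ q ℤ.* v i))
      ≡⟨ sum-cong-≗ (λ i → interchange (c i) p (u i) q (v i)) ⟩
    sum (λ i → p ℤ.* (c i ℤ.* u i) ℤ.+ q ℤ.* (c i ℤ.* v i))
      ≡⟨ ∑-distrib-+ (λ i → p ℤ.* (c i ℤ.* u i)) (λ i → q ℤ.* (c i ℤ.* v i)) ⟩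
    sum (λ i → p ℤ.* (c i ℤ.* u i)) ℤ.+ sum (λ i → q ℤ.* (c i ℤ.* v i))
      ≡⟨ cong₂ ℤ._+_ (sym (*-distribˡ-sum p (λ i → c i ℤ.* u i))) (sym (*-distribˡ-sum q (λ i → c i ℤ.* v i))) ⟩
    p ℤ.* (c · u) ℤ.+ q ℤ.* (c · v) ∎
    where open ≡-Reasoning

  ·-linearˡ : ∀ {n} p (b : Fin n → ℤ) q c v →
              (λ i → p ℤ.* b i ℤ.+ q ℤ.* c i) · v ≡ p ℤ.* (b · v) ℤ.+ q ℤ.* (c · v)
  ·-linearˡ p b q c v = begin
    (λ i → p ℤ.* b i ℤ.+ q ℤ.* c i) · v   ≡⟨ ·-comm (λ i → p ℤ.* b i ℤ.+ q ℤ.* c i) v ⟩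
    v · (λ i → p ℤ.* b i ℤ.+ q ℤ.* c i)   ≡⟨ ·-linearʳ v p b q c ⟩
    p ℤ.* (v · b) ℤ.+ q ℤ.* (v · c)       ≡⟨ cong₂ (λ s t → p ℤ.* s ℤ.+ q ℤ.* t) (·-comm v b) (·-comm v c) ⟩
    p ℤ.* (b · v) ℤ.+ q ℤ.* (c · v)       ∎
    where open ≡-Reasoning

  -- Coordinate i is the last one in which c does not vanish, so on the
  -- hyperplane c · v = 0 it is determined by the earlier ones, and dropping
  -- it does not change the lexicographic sign.
  record Redundant {n} (c : Fin (suc n) → ℤ) : Set where
    field
      i        : Fin (suc n)
      nonzero  : c i ≢ 0ℤ
      pos⁻     : ∀ v → c · v ≡ 0ℤ → Pos v → Pos (removeAt v i)
      pos⁺     : ∀ v → c · v ≡ 0ℤ → Pos (removeAt v i) → Pos v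
      zero⁺    : ∀ v → c · v ≡ 0ℤ → Zero (removeAt v i) → Zero v

  private
    head-zero : ∀ {n} (c v : Fin (suc n) → ℤ) → c zero ≢ 0ℤ → Zero (c ∘ suc) → c · v ≡ 0ℤ → v zero ≡ 0ℤ
    head-zero c v c≢0 z eq with ℤ.i*j≡0⇒i≡0∨j≡0 (c zero) {v zero}
        (trans (sym (trans (cong (λ t → (c zero ℤ.* v zero) ℤ.+ t) (·-zeroˡ (v ∘ suc) z)) (ℤ.+-identityʳ _))) eq)
    ... | inj₁ e = contradiction e c≢0
    ... | inj₂ e = e

    tail-· : ∀ {n} (c v : Fin (suc n) → ℤ) → v zero ≡ 0ℤ → c · v ≡ 0ℤ → (c ∘ suc) · (v ∘ suc) ≡ 0ℤ
    tail-· c v z eq = trans (sym (trans (cong (ℤ._+ ((c ∘ suc) · (v ∘ suc)))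
      (trans (cong (c zero ℤ.*_) z) (ℤ.*-zeroʳ (c zero)))) (ℤ.+-identityˡ _))) eq

  -- If v vanishes before the last nonzero coefficient of c, then c · v = 0 forces v to vanish there
  -- as well. So the first nonzero coordinate of v, which carries its sign, is never the dropped
  -- one.
  redundant : ∀ {n} (c : Fin (suc n) → ℤ) → ¬ Zero c → Redundant c
  redundant {n} c c≢0 with zero? (c ∘ suc)
  ... | yes z = record
    { i = zero ; nonzero = c₀
    ; pos⁻ = λ { v eq (here p) → contradiction (head-zero c v c₀ z eq) (ℤ.<⇒≢ p ∘ sym)
               ; v eq (there _ p) → p }
    ; pos⁺ = λ v eq p → there (head-zero c v c₀ z eq) p
    ; zero⁺ = λ { v eq q zero → head-zero c v c₀ z eq ; v eq q (suc j) → q j }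
    }
    where
    c₀ : c zero ≢ 0ℤ
    c₀ e = c≢0 λ { zero → e ; (suc j) → z j }
  redundant {zero}  c c≢0 | no ¬z = contradiction (λ ()) ¬z
  redundant {suc n} c c≢0 | no ¬z = record
    { i = suc R.i ; nonzero = R.nonzero
    ; pos⁻ = λ { v eq (here p) → here p
               ; v eq (there e p) → there e (R.pos⁻ (v ∘ suc) (tail-· c v e eq) p) }
    ; pos⁺ = λ { v eq (here p) → here p
               ; v eq (there e p) → there e (R.pos⁺ (v ∘ suc) (tail-· c v e eq) p) }
    ; zero⁺ = λ { v eq q zero → q zero
                ; v eq q (suc j) → R.zero⁺ (v ∘ suc) (tail-· c v (q zero) eq) (q ∘ suc) j }
    }
    where module R = Redundant (redundant (c ∘ suc) ¬z)

  nonNeg-+ : ∀ {n} {u v : Fin n → ℤ} → NonNeg u → NonNeg v → NonNeg (λ i → u i ℤ.+ v i)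
  nonNeg-+ (inj₁ p) q = inj₁ (pos-+ p q)
  nonNeg-+ {u = u} {v} (inj₂ z) (inj₁ p) = inj₁ (pos-cong (λ i → ℤ.+-comm (v i) (u i)) (pos-+ p (inj₂ z)))
  nonNeg-+ (inj₂ z) (inj₂ z′) = inj₂ (λ i → cong₂ ℤ._+_ (z i) (z′ i))

  nonNeg-antisym : ∀ {n} {v : Fin n → ℤ} → NonNeg v → NonNeg (λ i → ℤ.- v i) → Zero v
  nonNeg-antisym (inj₂ z) _        = z
  nonNeg-antisym (inj₁ p) (inj₁ q) = contradiction q (pos-asym p)
  nonNeg-antisym (inj₁ p) (inj₂ z) = λ i → ℤ.neg-injective (z i)

  -- Strictness before the returned index resolves ties in favour of the smallest index, so that
  -- each vector will fall into exactly one piece.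
  firstMin : ∀ {n} r (X : Fin (suc r) → Fin n → ℤ) → ∃ λ i →
             (∀ j → NonNeg (λ t → X j t ℤ.- X i t)) ×
             (∀ j → j Fin.< i → Pos (λ t → X j t ℤ.- X i t))
  firstMin zero X = zero , (λ { zero → inj₂ λ t → ℤ.+-inverseʳ (X zero t) }) , λ _ ()
  firstMin (suc r) X with firstMin r (X ∘ suc)
  ... | i , min , strict with trichotomy (λ t → X zero t ℤ.- X (suc i) t)
  ...   | inj₁ p = suc i , (λ { zero → inj₁ p ; (suc j) → min j })
                 , λ { zero _ → p ; (suc j) j<i → strict j (ℕ.s<s⁻¹ j<i) }
  ...   | inj₂ q = zero , (λ { zero → inj₂ λ t → ℤ.+-inverseʳ (X zero t)
                             ; (suc j) → nonNeg-cong (λ t → telescope (X (suc j) t) (X (suc i) t) (X zero t))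
                                           (nonNeg-+ (min j) (flip q)) })
                 , λ _ ()
    where
    telescope : ∀ a b c → (a ℤ.- b) ℤ.+ ℤ.- (c ℤ.- b) ≡ a ℤ.- c
    telescope = solve-∀
    flip : ∀ {n} {v : Fin n → ℤ} → Zero v ⊎ Pos (λ i → ℤ.- v i) → NonNeg (λ i → ℤ.- v i)
    flip (inj₁ z) = inj₂ (λ i → cong ℤ.-_ (z i))
    flip (inj₂ p) = inj₁ p

-- Coefficients of rational generating functions

open Cardinality
open Lex

-- The coefficient of tᵏ in tᵃ / (1 - t)ⁿ.
coeff : ℕ → ℕ → ℕ → ℕ
coeff zero    zero    zero    = 1
coeff zero    zero    (suc k) = 0
coeff zero    (suc a) zero    = 0
coeff zero    (suc a) (suc k) = coeff zero a k
coeff (suc n) a       zero    = coeff n a zero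
coeff (suc n) a       (suc k) = coeff n a (suc k) ℕ.+ coeff (suc n) a k

coeff-shift-zero : ∀ n a → coeff n (suc a) zero ≡ 0
coeff-shift-zero zero    a = refl
coeff-shift-zero (suc n) a = coeff-shift-zero n a

coeff-shift : ∀ n a k → coeff n (suc a) (suc k) ≡ coeff n a k
coeff-shift zero    a k       = refl
coeff-shift (suc n) a zero    =
  trans (cong₂ ℕ._+_ (coeff-shift n a zero) (coeff-shift-zero n a)) (ℕ.+-identityʳ _)
coeff-shift (suc n) a (suc k) = cong₂ ℕ._+_ (coeff-shift n a (suc k)) (coeff-shift (suc n) a k)

-- The coefficient of tᵏ in (Σ tᵃ) / (1 - t)ⁿ: a numerator with nonnegative coefficients is stored
-- as the list of its exponents.
total : ℕ → List ℕ → ℕ → ℕ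
total n []       k = 0
total n (a ∷ as) k = coeff n a k ℕ.+ total n as k

total-++ : ∀ n as bs k → total n (as List.++ bs) k ≡ total n as k ℕ.+ total n bs k
total-++ n []       bs k = refl
total-++ n (a ∷ as) bs k =
  trans (cong (coeff n a k ℕ.+_) (total-++ n as bs k)) (sym (ℕ.+-assoc (coeff n a k) _ _))

total-shift-zero : ∀ n as → total n (List.map suc as) zero ≡ 0
total-shift-zero n []       = refl
total-shift-zero n (a ∷ as) = cong₂ ℕ._+_ (coeff-shift-zero n a) (total-shift-zero n as)

total-shift : ∀ n as k → total n (List.map suc as) (suc k) ≡ total n as k
total-shift n []       k = refl
total-shift n (a ∷ as) k = cong₂ ℕ._+_ (coeff-shift n a k) (total-shift n as k)

-- On generating functions this is multiplication by 1 / (1 - t), the effect of a product with a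
-- ray.
accumulate : (ℕ → ℕ) → ℕ → ℕ
accumulate g zero    = g zero
accumulate g (suc k) = g (suc k) ℕ.+ accumulate g k

accumulate-total : ∀ n as k → accumulate (total n as) k ≡ total (suc n) as k
accumulate-total n []       zero    = refl
accumulate-total n []       (suc k) = accumulate-total n [] k
accumulate-total n (a ∷ as) zero    = cong (coeff n a zero ℕ.+_) (accumulate-total n as zero)
accumulate-total n (a ∷ as) (suc k) = begin
  (p ℕ.+ q) ℕ.+ accumulate (total n (a ∷ as)) k     ≡⟨ cong ((p ℕ.+ q) ℕ.+_) (accumulate-total n (a ∷ as) k) ⟩
  (p ℕ.+ q) ℕ.+ (coeff (suc n) a k ℕ.+ total (suc n) as k)
    ≡⟨ cong (λ t → (p ℕ.+ q) ℕ.+ (coeff (suc n) a k ℕ.+ t)) (accumulate-total n as k) ⟨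
  (p ℕ.+ q) ℕ.+ (coeff (suc n) a k ℕ.+ accumulate (total n as) k)
    ≡⟨ ℕ.+-assoc p q _ ⟩
  p ℕ.+ (q ℕ.+ (coeff (suc n) a k ℕ.+ accumulate (total n as) k))
    ≡⟨ cong (p ℕ.+_) (ℕ.+-assoc q _ _) ⟨
  p ℕ.+ ((q ℕ.+ coeff (suc n) a k) ℕ.+ accumulate (total n as) k)
    ≡⟨ cong (λ t → p ℕ.+ (t ℕ.+ accumulate (total n as) k)) (ℕ.+-comm q _) ⟩
  p ℕ.+ ((coeff (suc n) a k ℕ.+ q) ℕ.+ accumulate (total n as) k)
    ≡⟨ cong (p ℕ.+_) (ℕ.+-assoc (coeff (suc n) a k) q _) ⟩
  p ℕ.+ (coeff (suc n) a k ℕ.+ (q ℕ.+ accumulate (total n as) k))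
    ≡⟨ ℕ.+-assoc p _ _ ⟨
  (p ℕ.+ coeff (suc n) a k) ℕ.+ (q ℕ.+ accumulate (total n as) k)
    ≡⟨ cong ((p ℕ.+ coeff (suc n) a k) ℕ.+_) (accumulate-total n as (suc k)) ⟩
  (p ℕ.+ coeff (suc n) a k) ℕ.+ total (suc n) as (suc k) ∎
  where
  open ≡-Reasoning
  p = coeff n a (suc k)
  q = total n as (suc k)

-- Decomposition into half-open unimodular cones

-- L k x says that x lies in a lattice of integer vectors and has degree k. The
-- elements of degree 1 with entries 0 and 1 are the ind μ, with support edge μ;
-- generated is Birkhoff's theorem.
record Cone (E : Set) (r : ℕ) : Set₁ where
  field
    L          : ℤ → (E → ℤ) → Set
    L-cong     : ∀ {k x y} → x ≗ y → L k x → L k y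
    L-combine  : ∀ {k l x y} p q → L k x → L l y →
                 L (p ℤ.* k ℤ.+ q ℤ.* l) (λ f → p ℤ.* x f ℤ.+ q ℤ.* y f)
    L-0        : L 0ℤ (λ _ → 0ℤ)
    L-nonNeg   : ∀ {k x} → L k x → (∀ f → 0ℤ ℤ.≤ x f) → 0ℤ ℤ.≤ k
    L-zero     : ∀ {x} → L 0ℤ x → (∀ f → 0ℤ ℤ.≤ x f) → ∀ f → x f ≡ 0ℤ
    L-trivial  : ∀ {k x} → L k x → (∀ f → x f ≡ 0ℤ) → k ≡ 0ℤ
    Generator  : Set
    edge       : Generator → Fin r → E
    ind        : Generator → E → ℤ
    ind-L      : ∀ μ → L 1ℤ (ind μ)
    ind-edge   : ∀ μ i → ind μ (edge μ i) ≡ 1ℤ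
    ind-cases  : ∀ μ f → ind μ f ≡ 0ℤ ⊎ ∃ λ i → f ≡ edge μ i
    search     : ∀ {Q : E → Set} → (∀ f → Dec (Q f)) → Dec (∃ λ μ → ∀ i → Q (edge μ i))
    generated  : ∀ {k x} → L (+ suc k) x → (∀ f → 0ℤ ℤ.≤ x f) → ∃ λ μ → ∀ i → 0ℤ ℤ.< x (edge μ i)

module Decomposition {E : Set} {r : ℕ} (cone : Cone E r) where
  open Cone cone

  -- ε f lists the coordinates, from the largest to the smallest order of
  -- magnitude, of the infinitesimal attached to the cell f.
  record Frame {n} (ε : E → Fin n → ℤ) : Set where
    field
      independent : ∀ c → (∀ f → c · ε f ≡ 0ℤ) → Zero c
      -- Eliminated cells are those with ε f = 0. Up to the factor a, the coordinates form a
      -- rational basis of the lattice elements that vanish on these cells, so n is the dimension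
      -- left.
      spanning    : ∀ {k x} → L k x → (∀ f → Zero (ε f) → x f ≡ 0ℤ) →
                    ∃ λ a → a ≢ 0ℤ × ∃ λ c → ∀ f → a ℤ.* x f ≡ c · ε f
      coordinate  : ∀ i → ∃ λ k → L k (λ f → ε f i)

  open Frame

  -- The perturbed entry m + s v in lexicographic form: the integer part outranks every
  -- infinitesimal.
  ext : ∀ {n} → ℤ → ℤ → (Fin n → ℤ) → Fin (suc n) → ℤ
  ext s m v zero    = m
  ext s m v (suc j) = s ℤ.* v j

  -- The condition m + s v > 0 on the entry m of a cell with infinitesimal v;
  -- where v = 0 the cell has been eliminated and its entry must vanish.
  Cell : ∀ {n} → ℤ → ℤ → (Fin n → ℤ) → Set
  Cell s m v = (Zero v × m ≡ 0ℤ) ⊎ (¬ Zero v × Pos (ext s m v))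

  record Region {n} (s : ℤ) (ε : E → Fin n → ℤ) (k : ℕ) (x : E → ℤ) : Set where
    constructor _,_
    field
      magic : L (+ k) x
      cells : ∀ f → Cell s (x f) (ε f)

  module _ {n} (s : ℤ) (ε : E → Fin n → ℤ) where

    region-resp : ∀ k → Respects (Region s ε k)
    region-resp k eq (l , cell) = L-cong eq l , λ f → subst (λ m → Cell s m (ε f)) (eq f) (cell f)

    region-nonNeg : ∀ {k x} → Region s ε k x → ∀ f → 0ℤ ℤ.≤ x f
    region-nonNeg (_ , cell) f with cell f
    ... | inj₁ (_ , z) = ℤ.≤-reflexive (sym z)
    ... | inj₂ (_ , p) = nonNeg-head (inj₁ p)

    region-off : ∀ {k x} → Region s ε k x → ∀ f → Zero (ε f) → x f ≡ 0ℤ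
    region-off (_ , cell) f z with cell f
    ... | inj₁ (_ , e)  = e
    ... | inj₂ (¬z , _) = contradiction z ¬z

  sub : (E → ℤ) → ℤ → (E → ℤ) → E → ℤ
  sub x m y f = x f ℤ.- m ℤ.* y f

  private
    as-combination : ∀ u p v → 1ℤ ℤ.* u ℤ.+ (ℤ.- p) ℤ.* v ≡ u ℤ.- p ℤ.* v
    as-combination = solve-∀
    swap-combination : ∀ u p v → 1ℤ ℤ.* u ℤ.+ (ℤ.- p) ℤ.* v ≡ u ℤ.- v ℤ.* p
    swap-combination = solve-∀
    restore : ∀ u p v → 1ℤ ℤ.* (u ℤ.- p ℤ.* v) ℤ.+ p ℤ.* v ≡ u
    restore = solve-∀
    sub-sub : ∀ u p v → u ℤ.- v ℤ.- p ℤ.* v ≡ u ℤ.- (1ℤ ℤ.+ p) ℤ.* v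
    sub-sub = solve-∀
    sub-0 : ∀ u v → u ℤ.- 0ℤ ℤ.* v ≡ u
    sub-0 = solve-∀
    sub-by-0 : ∀ u p → u ℤ.- p ℤ.* 0ℤ ≡ u
    sub-by-0 = solve-∀
    sub-by-0ˡ : ∀ u p → u ℤ.- 0ℤ ℤ.* p ≡ u
    sub-by-0ˡ = solve-∀
    sub-by-1 : ∀ u p → u ℤ.- p ℤ.* 1ℤ ≡ u ℤ.- p
    sub-by-1 = solve-∀
    ext-tail : ∀ s u p v → s ℤ.* (u ℤ.- p ℤ.* v) ≡ s ℤ.* u ℤ.- p ℤ.* (s ℤ.* v)
    ext-tail = solve-∀
    one-sub : ∀ u v → u ℤ.- 1ℤ ℤ.* v ≡ u ℤ.- v
    one-sub = solve-∀

  L-sub : ∀ {k l x y} m → L k x → L l y → L (k ℤ.- m ℤ.* l) (sub x m y)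
  L-sub {k} {l} {x} {y} m Lx Ly =
    subst (λ t → L t (sub x m y)) (as-combination k m l)
      (L-cong (λ f → as-combination (x f) m (y f)) (L-combine 1ℤ (ℤ.- m) Lx Ly))

  ·-sub : ∀ {n} (c : Fin n → ℤ) u p v → c · (λ j → u j ℤ.- p ℤ.* v j) ≡ c · u ℤ.- p ℤ.* (c · v)
  ·-sub c u p v = trans (sum-cong-≗ λ j → cong (c j ℤ.*_) (sym (as-combination (u j) p (v j))))
    (trans (·-linearʳ c 1ℤ u (ℤ.- p) v) (as-combination (c · u) p (c · v)))

  drop-· : ∀ {n} (c : Fin (suc n) → ℤ) v i → c i ≡ 0ℤ → c · v ≡ removeAt c i · removeAt v i
  drop-· c v i z = trans (sum-remove {i = i} (λ j → c j ℤ.* v j))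
    (trans (cong (ℤ._+ (removeAt c i · removeAt v i)) (trans (cong (ℤ._* v i) z) (ℤ.*-zeroˡ (v i))))
      (ℤ.+-identityˡ _))

  *-cancel : ∀ {a x y} → a ≢ 0ℤ → a ℤ.* x ≡ a ℤ.* y → x ≡ y
  *-cancel {a} {x} {y} a≢0 = ℤ.*-cancelˡ-≡ a x y {{ℤ.≢-nonZero a≢0}}

  *-zero : ∀ {a x} → a ≢ 0ℤ → a ℤ.* x ≡ 0ℤ → x ≡ 0ℤ
  *-zero {a} a≢0 e = *-cancel a≢0 (trans e (sym (ℤ.*-zeroʳ a)))

  -- Genericity of ε: entries are linear in the infinitesimals because the coordinates span. A tie
  -- between two perturbed entries is therefore a tie for all x simultaneously.
  tie : ∀ {n} {ε : E → Fin n → ℤ} → Frame ε → ∀ {k x} → L k x → (∀ f → Zero (ε f) → x f ≡ 0ℤ) →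
        ∀ {e f} → ε e ≗ ε f → x e ≡ x f
  tie {ε = ε} fr l off {e} {f} eq with spanning fr l off
  ... | a , a≢0 , c , span = *-cancel a≢0
    (trans (span e) (trans (sum-cong-≗ λ j → cong (c j ℤ.*_) (eq j)) (sym (span f))))

  natural : ∀ {m} → 0ℤ ℤ.≤ m → ∃ λ n → m ≡ + n
  natural {+ n} _ = n , refl

  module Step {n} (ε : E → Fin (suc n) → ℤ) (fr : Frame ε) (μ : Generator)
              (supp : ∀ i → ¬ Zero (ε (edge μ i))) where

    private
      π : E → ℤ
      π = ind μ
      e : Fin r → E
      e = edge μ

      π-off : ∀ f → Zero (ε f) → π f ≡ 0ℤ
      π-off f z with ind-cases μ f
      ... | inj₁ p        = p
      ... | inj₂ (i , eq) = contradiction (subst (Zero ∘ ε) eq z) (supp i)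

      span-π : ∃ λ a → a ≢ 0ℤ × ∃ λ c → ∀ f → a ℤ.* π f ≡ c · ε f
      span-π = spanning fr (ind-L μ) π-off

    a : ℤ
    a = proj₁ span-π
    a≢0 : a ≢ 0ℤ
    a≢0 = proj₁ (proj₂ span-π)
    c : Fin (suc n) → ℤ
    c = proj₁ (proj₂ (proj₂ span-π))
    relation : ∀ f → a ℤ.* π f ≡ c · ε f
    relation = proj₂ (proj₂ (proj₂ span-π))

    c≢0 : ¬ Zero c
    c≢0 z = contradiction (L-trivial (ind-L μ) λ f → *-zero a≢0 (trans (relation f) (·-zeroˡ (ε f) z)))
              λ ()

    open Redundant (redundant c c≢0) renaming (i to ι)

    -- The infinitesimal that remains in cell f once the one of `e i` is subtracted along π, just as
    -- the entry of x at `e i` is subtracted along π.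
    pivot : Fin r → E → Fin (suc n) → ℤ
    pivot i f j = ε f j ℤ.- π f ℤ.* ε (e i) j

    ε′ : Fin r → E → Fin n → ℤ
    ε′ i f = removeAt (pivot i f) ι

    -- This hyperplane is what allows coordinate `ι` to be dropped: `redundant` recovers signs and
    -- zeros of the pivots from the other coordinates.
    c·pivot : ∀ i f → c · pivot i f ≡ 0ℤ
    c·pivot i f = begin
      c · pivot i f                               ≡⟨ ·-sub c (ε f) (π f) (ε (e i)) ⟩
      c · ε f ℤ.- π f ℤ.* (c · ε (e i))           ≡⟨ cong₂ (λ p q → p ℤ.- π f ℤ.* q) (relation f) (relation (e i)) ⟨
      a ℤ.* π f ℤ.- π f ℤ.* (a ℤ.* π (e i))       ≡⟨ cong (λ t → a ℤ.* π f ℤ.- π f ℤ.* (a ℤ.* t)) (ind-edge μ i) ⟩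
      a ℤ.* π f ℤ.- π f ℤ.* (a ℤ.* 1ℤ)            ≡⟨ cancel a (π f) ⟩
      0ℤ                                          ∎
      where
      open ≡-Reasoning
      cancel : ∀ a p → a ℤ.* p ℤ.- p ℤ.* (a ℤ.* 1ℤ) ≡ 0ℤ
      cancel = solve-∀

    ε′-zero : ∀ {i f} → Zero (ε′ i f) → Zero (pivot i f)
    ε′-zero {i} {f} = zero⁺ (pivot i f) (c·pivot i f)

    zero-ε′ : ∀ {i f} → Zero (pivot i f) → Zero (ε′ i f)
    zero-ε′ z j = z (punchIn ι j)

    pivot-self : ∀ i → Zero (pivot i (e i))
    pivot-self i j = trans (cong (λ p → ε (e i) j ℤ.- p ℤ.* ε (e i) j) (ind-edge μ i)) (self (ε (e i) j))
      where
      self : ∀ u → u ℤ.- 1ℤ ℤ.* u ≡ 0ℤ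
      self = solve-∀

    pivot-off : ∀ i f → π f ≡ 0ℤ → pivot i f ≗ ε f
    pivot-off i f z j = trans (cong (λ p → ε f j ℤ.- p ℤ.* ε (e i) j) z) (sub-by-0ˡ (ε f j) (ε (e i) j))

    pivot-edge : ∀ i i′ j → pivot i (e i′) j ≡ ε (e i′) j ℤ.- ε (e i) j
    pivot-edge i i′ j = trans (cong (λ p → ε (e i′) j ℤ.- p ℤ.* ε (e i) j) (ind-edge μ i′))
                              (one-sub (ε (e i′) j) (ε (e i) j))

    frame′ : ∀ i → Frame (ε′ i)
    frame′ i = record { independent = ind′ ; spanning = span′ ; coordinate = coord′ }
      where
      open ≡-Reasoning
      ind′ : ∀ c′ → (∀ f → c′ · ε′ i f ≡ 0ℤ) → Zero c′
      ind′ c′ orth = λ j → trans (sym (insertAt-punchIn c′ ι 0ℤ j)) (ĉ-zero (punchIn ι j))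
        where
        ĉ : Fin (suc n) → ℤ
        ĉ = insertAt c′ ι 0ℤ
        ĉ·pivot : ∀ f → ĉ · pivot i f ≡ 0ℤ
        ĉ·pivot f = begin
          ĉ · pivot i f                            ≡⟨ drop-· ĉ (pivot i f) ι (insertAt-lookup c′ ι 0ℤ) ⟩
          removeAt ĉ ι · ε′ i f                    ≡⟨ sum-cong-≗ (λ j → cong (ℤ._* ε′ i f j) (insertAt-punchIn c′ ι 0ℤ j)) ⟩
          c′ · ε′ i f                              ≡⟨ orth f ⟩
          0ℤ                                       ∎
        q : ℤ
        q = ĉ · ε (e i)
        ĉ·ε : ∀ f → ĉ · ε f ≡ π f ℤ.* q
        ĉ·ε f = ℤ.i-j≡0⇒i≡j _ _ (trans (sym (·-sub ĉ (ε f) (π f) (ε (e i)))) (ĉ·pivot f))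
        -- Both `ĉ` and c pair with ε to multiples of π, so by independence of the old frame they
        -- are proportional; but `ĉ` vanishes at `ι` and c does not, which leaves only `ĉ` = 0.
        combination-zero : Zero (λ j → a ℤ.* ĉ j ℤ.+ (ℤ.- q) ℤ.* c j)
        combination-zero = independent fr _ λ f → begin
          (λ j → a ℤ.* ĉ j ℤ.+ (ℤ.- q) ℤ.* c j) · ε f   ≡⟨ ·-linearˡ a ĉ (ℤ.- q) c (ε f) ⟩
          a ℤ.* (ĉ · ε f) ℤ.+ (ℤ.- q) ℤ.* (c · ε f)     ≡⟨ cong₂ (λ s t → a ℤ.* s ℤ.+ (ℤ.- q) ℤ.* t) (ĉ·ε f) (sym (relation f)) ⟩
          a ℤ.* (π f ℤ.* q) ℤ.+ (ℤ.- q) ℤ.* (a ℤ.* π f) ≡⟨ cancel a (π f) q ⟩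
          0ℤ                                            ∎
          where
          cancel : ∀ a p q → a ℤ.* (p ℤ.* q) ℤ.+ (ℤ.- q) ℤ.* (a ℤ.* p) ≡ 0ℤ
          cancel = solve-∀
        c·q≡0 : c ι ℤ.* q ≡ 0ℤ
        c·q≡0 = begin
          c ι ℤ.* q                                       ≡⟨ rearrange a q (c ι) ⟩
          a ℤ.* 0ℤ ℤ.- (a ℤ.* 0ℤ ℤ.+ (ℤ.- q) ℤ.* c ι)     ≡⟨ cong₂ (λ s t → s ℤ.- t) (ℤ.*-zeroʳ a)
              (trans (cong (λ t → a ℤ.* t ℤ.+ (ℤ.- q) ℤ.* c ι) (sym (insertAt-lookup c′ ι 0ℤ))) (combination-zero ι)) ⟩
          0ℤ                                              ∎
          where
          rearrange : ∀ a q u → u ℤ.* q ≡ a ℤ.* 0ℤ ℤ.- (a ℤ.* 0ℤ ℤ.+ (ℤ.- q) ℤ.* u)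
          rearrange = solve-∀
        q≡0 : q ≡ 0ℤ
        q≡0 = *-zero nonzero c·q≡0
        ĉ-zero : Zero ĉ
        ĉ-zero j = *-zero a≢0 (trans (simplify a (ĉ j) (c j))
          (trans (cong (λ t → a ℤ.* ĉ j ℤ.+ (ℤ.- t) ℤ.* c j) (sym q≡0)) (combination-zero j)))
          where
          simplify : ∀ a u v → a ℤ.* u ≡ a ℤ.* u ℤ.+ (ℤ.- 0ℤ) ℤ.* v
          simplify = solve-∀

      span′ : ∀ {k x} → L k x → (∀ f → Zero (ε′ i f) → x f ≡ 0ℤ) →
              ∃ λ a → a ≢ 0ℤ × ∃ λ c → ∀ f → a ℤ.* x f ≡ c · ε′ i f
      span′ {k} {x} l off with spanning fr l off′
        where
        off′ : ∀ f → Zero (ε f) → x f ≡ 0ℤ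
        off′ f z = off f (zero-ε′ λ j → trans (pivot-off i f (π-off f z) j) (z j))
      ... | b , b≢0 , d , span = c ι ℤ.* b , product≢0 , removeAt d̂ ι , span″
        where
        product≢0 : c ι ℤ.* b ≢ 0ℤ
        product≢0 eq = b≢0 (*-zero nonzero eq)
        -- Adding a multiple of c changes nothing on the pivots, where c vanishes. This multiple
        -- clears coordinate `ι`, at the price of the factor `c ι`.
        d̂ : Fin (suc n) → ℤ
        d̂ j = c ι ℤ.* d j ℤ.+ (ℤ.- d ι) ℤ.* c j
        d̂ι : d̂ ι ≡ 0ℤ
        d̂ι = cancel (c ι) (d ι)
          where
          cancel : ∀ u v → u ℤ.* v ℤ.+ (ℤ.- v) ℤ.* u ≡ 0ℤ
          cancel = solve-∀
        x-e : x (e i) ≡ 0ℤ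
        x-e = off (e i) (zero-ε′ (pivot-self i))
        d·pivot : ∀ f → d · pivot i f ≡ b ℤ.* x f
        d·pivot f = begin
          d · pivot i f                               ≡⟨ ·-sub d (ε f) (π f) (ε (e i)) ⟩
          d · ε f ℤ.- π f ℤ.* (d · ε (e i))           ≡⟨ cong₂ (λ s t → s ℤ.- π f ℤ.* t) (sym (span f)) (trans (sym (span (e i))) (cong (b ℤ.*_) x-e)) ⟩
          b ℤ.* x f ℤ.- π f ℤ.* (b ℤ.* 0ℤ)            ≡⟨ cancel (b ℤ.* x f) (π f) b ⟩
          b ℤ.* x f                                   ∎
          where
          cancel : ∀ u p b → u ℤ.- p ℤ.* (b ℤ.* 0ℤ) ≡ u
          cancel = solve-∀
        span″ : ∀ f → c ι ℤ.* b ℤ.* x f ≡ removeAt d̂ ι · ε′ i f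
        span″ f = begin
          c ι ℤ.* b ℤ.* x f                                            ≡⟨ expand (c ι) b (x f) (d ι) ⟩
          c ι ℤ.* (b ℤ.* x f) ℤ.+ (ℤ.- d ι) ℤ.* 0ℤ                     ≡⟨ cong₂ (λ s t → c ι ℤ.* s ℤ.+ (ℤ.- d ι) ℤ.* t) (d·pivot f) (c·pivot i f) ⟨
          c ι ℤ.* (d · pivot i f) ℤ.+ (ℤ.- d ι) ℤ.* (c · pivot i f)    ≡⟨ ·-linearˡ (c ι) d (ℤ.- d ι) c (pivot i f) ⟨
          d̂ · pivot i f                                                ≡⟨ drop-· d̂ (pivot i f) ι d̂ι ⟩
          removeAt d̂ ι · ε′ i f                                        ∎
          where
          expand : ∀ u b x v → u ℤ.* b ℤ.* x ≡ u ℤ.* (b ℤ.* x) ℤ.+ (ℤ.- v) ℤ.* 0ℤ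
          expand = solve-∀

      coord′ : ∀ j → ∃ λ k → L k (λ f → ε′ i f j)
      coord′ j with coordinate fr (punchIn ι j)
      ... | k , l = _ , L-cong (λ f → swap-combination (ε f (punchIn ι j)) (ε (e i) (punchIn ι j)) (π f))
                          (L-combine 1ℤ (ℤ.- ε (e i) (punchIn ι j)) l (ind-L μ))

    -- By `tie`, cells of π with equal infinitesimals have equal entries and would give the same
    -- piece twice, so only the first of them is kept. The choice depends on neither x nor s.
    Ok : Fin r → Set
    Ok i = ∀ i′ → i′ Fin.< i → ¬ (ε (e i′) ≗ ε (e i))

    ok? : ∀ i → Dec (Ok i)
    ok? i = Fin.all? λ i′ → (i′ Fin.<? i) →-dec ¬? (Fin.all? λ j → ε (e i′) j ℤ.≟ ε (e i) j)

    module Pieces (s : ℤ) (s≢0 : s ≢ 0ℤ) where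

      X : (E → ℤ) → E → Fin (suc (suc n)) → ℤ
      X x f = ext s (x f) (ε f)

      Piece : ℕ → Fin r → (E → ℤ) → Set
      Piece k i x = Ok i × ∃ λ m → ∃ λ j → m ℕ.+ j ≡ k ×
        Region s (ε′ i) j (sub x (+ m) π) × Pos (ext s (+ m) (ε (e i)))

      scale-zero : ∀ {m} {v : Fin m → ℤ} → Zero (λ j → s ℤ.* v j) → Zero v
      scale-zero z j = *-zero s≢0 (z j)

      ·-scale : ∀ {v : Fin (suc n) → ℤ} → c · v ≡ 0ℤ → c · (λ j → s ℤ.* v j) ≡ 0ℤ
      ·-scale {v} eq = begin
        c · (λ j → s ℤ.* v j)       ≡⟨ sum-cong-≗ (λ j → move (c j) s (v j)) ⟩
        c · (λ j → 0ℤ ℤ.- (ℤ.- s) ℤ.* v j) ≡⟨ ·-sub c (λ _ → 0ℤ) (ℤ.- s) v ⟩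
        c · (λ _ → 0ℤ) ℤ.- (ℤ.- s) ℤ.* (c · v) ≡⟨ cong₂ (λ p q → p ℤ.- (ℤ.- s) ℤ.* q) (·-zeroʳ c (λ _ → refl)) eq ⟩
        0ℤ ℤ.- (ℤ.- s) ℤ.* 0ℤ ≡⟨ sub-by-0 0ℤ (ℤ.- s) ⟩
        0ℤ ∎
        where
        open ≡-Reasoning
        move : ∀ c s v → c ℤ.* (s ℤ.* v) ≡ c ℤ.* (0ℤ ℤ.- (ℤ.- s) ℤ.* v)
        move = solve-∀

      ext-pos⁻ : ∀ {m} {v} → c · v ≡ 0ℤ → Pos (ext s m v) → Pos (ext s m (removeAt v ι))
      ext-pos⁻ eq (here p) = here p
      ext-pos⁻ {v = v} eq (there z p) = there z (pos⁻ (λ j → s ℤ.* v j) (·-scale {v} eq) p)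

      ext-pos⁺ : ∀ {m} {v} → c · v ≡ 0ℤ → Pos (ext s m (removeAt v ι)) → Pos (ext s m v)
      ext-pos⁺ eq (here p) = here p
      ext-pos⁺ {v = v} eq (there z p) = there z (pos⁺ (λ j → s ℤ.* v j) (·-scale {v} eq) p)

      ext-zero : ∀ {k m} {v : Fin k → ℤ} → m ≡ 0ℤ → Zero v → Zero (ext s m v)
      ext-zero z zs zero    = z
      ext-zero z zs (suc j) = trans (cong (s ℤ.*_) (zs j)) (ℤ.*-zeroʳ s)

      ext-cong : ∀ {k m m′} {v v′ : Fin k → ℤ} → m ≡ m′ → v ≗ v′ → ext s m v ≗ ext s m′ v′
      ext-cong p q zero    = p
      ext-cong p q (suc j) = cong (s ℤ.*_) (q j)

      ext-pivot : ∀ i x m f → ext s (sub x m π f) (pivot i f) ≗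
                  (λ t → X x f t ℤ.- π f ℤ.* ext s m (ε (e i)) t)
      ext-pivot i x m f zero    = cong (λ t → x f ℤ.- t) (ℤ.*-comm m (π f))
      ext-pivot i x m f (suc j) = ext-tail s (ε f j) (π f) (ε (e i) j)

      ext-pivot-edge : ∀ i x m i′ → ext s (sub x m π (e i′)) (pivot i (e i′)) ≗
                       (λ t → X x (e i′) t ℤ.- ext s m (ε (e i)) t)
      ext-pivot-edge i x m i′ t = trans (ext-pivot i x m (e i′) t)
        (trans (cong (λ p → X x (e i′) t ℤ.- p ℤ.* ext s m (ε (e i)) t) (ind-edge μ i′))
          (one-sub (X x (e i′) t) (ext s m (ε (e i)) t)))

      cell′-nonNeg : ∀ {i m f} → Cell s m (ε′ i f) → NonNeg (ext s m (pivot i f))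
      cell′-nonNeg {i} {m} {f} (inj₁ (z , eq)) = inj₂ (ext-zero eq (ε′-zero z))
      cell′-nonNeg {i} {m} {f} (inj₂ (_ , p))  = inj₁ (ext-pos⁺ {m} {pivot i f} (c·pivot i f) p)

      sub-edge : ∀ x m i → sub x m π (e i) ≡ x (e i) ℤ.- m
      sub-edge x m i = trans (cong (λ p → x (e i) ℤ.- m ℤ.* p) (ind-edge μ i)) (sub-by-1 (x (e i)) m)

      region⇒piece : ∀ {r′} → r ≡ suc r′ → ∀ {k x} → Region s ε k x → ∃ λ i → Piece k i x
      region⇒piece refl {k} {x} reg@(l , cell) with firstMin _ (λ i → X x (e i))
      ... | i , min , strict with natural (region-nonNeg s ε reg (e i))
      ...   | m , xe = i , ok , m , remaining (+ k ℤ.- + m ℤ.* 1ℤ) refl (L-nonNeg l′ nonneg′)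
        where
        ok : Ok i
        ok i′ i′<i eq = pos⇒¬zero (strict i′ i′<i) λ
          { zero    → ℤ.i≡j⇒i-j≡0 (tie fr l (region-off s ε reg) eq)
          ; (suc j) → ℤ.i≡j⇒i-j≡0 (cong (s ℤ.*_) (eq j)) }

        pos-e : Pos (ext s (+ m) (ε (e i)))
        pos-e with cell (e i)
        ... | inj₁ (z , _) = contradiction z (supp i)
        ... | inj₂ (_ , p) = pos-cong (ext-cong {v = ε (e i)} xe (λ _ → refl)) p

        x′ : E → ℤ
        x′ = sub x (+ m) π

        l′ : L (+ k ℤ.- + m ℤ.* 1ℤ) x′
        l′ = L-sub (+ m) l (ind-L μ)

        min′ : ∀ i′ → NonNeg (ext s (x′ (e i′)) (pivot i (e i′)))
        min′ i′ = nonNeg-cong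
          (λ t → trans (cong (λ y → X x (e i′) t ℤ.- y) (ext-cong {v = ε (e i)} xe (λ _ → refl) t)) (sym (ext-pivot-edge i x (+ m) i′ t)))
          (min i′)

        x′-off : ∀ f → π f ≡ 0ℤ → x′ f ≡ x f
        x′-off f z = trans (cong (λ p → x f ℤ.- + m ℤ.* p) z) (sub-by-0 (x f) (+ m))

        cell′ : ∀ f → Cell s (x′ f) (ε′ i f)
        cell′ f with ind-cases μ f
        cell′ f | inj₁ z with cell f
        ... | inj₁ (zc , zx) = inj₁ (zero-ε′ (λ j → trans (pivot-off i f z j) (zc j)) , trans (x′-off f z) zx)
        ... | inj₂ (nz , p)  = inj₂
          ( (λ zc → nz λ j → trans (sym (pivot-off i f z j)) (ε′-zero zc j))
          , ext-pos⁻ {v = pivot i f} (c·pivot i f)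
              (pos-cong (ext-cong (sym (x′-off f z)) (λ j → sym (pivot-off i f z j))) p) )
        cell′ f | inj₂ (i′ , refl) with zero? (pivot i (e i′)) | min′ i′
        -- Equal infinitesimals force equal entries, so this cell is eliminated along with `e i`.
        ... | yes z | _ = inj₁ (zero-ε′ z , trans (sub-edge x (+ m) i′)
                (ℤ.i≡j⇒i-j≡0 (trans (tie fr l (region-off s ε reg)
                  λ j → ℤ.i-j≡0⇒i≡j _ _ (trans (sym (pivot-edge i i′ j)) (z j))) xe)))
        ... | no ¬z | inj₁ p = inj₂ ((λ z → ¬z (ε′-zero z)) , ext-pos⁻ {v = pivot i (e i′)} (c·pivot i (e i′)) p)
        ... | no ¬z | inj₂ z = contradiction (scale-zero (z ∘ suc)) ¬z

        nonneg′ : ∀ f → 0ℤ ℤ.≤ x′ f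
        nonneg′ f with cell′ f
        ... | inj₁ (_ , z) = ℤ.≤-reflexive (sym z)
        ... | inj₂ (_ , p) = nonNeg-head (inj₁ p)

        remaining : ∀ t → t ≡ + k ℤ.- + m ℤ.* 1ℤ → 0ℤ ℤ.≤ t → ∃ λ j → m ℕ.+ j ≡ k ×
                    Region s (ε′ i) j x′ × Pos (ext s (+ m) (ε (e i)))
        remaining (+ j) eq _ = j , ℤ.+-injective (trans (cong (ℤ._+_ (+ m)) eq) (sum-back (+ k) (+ m)))
                             , (subst (λ t → L t x′) (sym eq) l′ , cell′) , pos-e
          where
          sum-back : ∀ k m → m ℤ.+ (k ℤ.- m ℤ.* 1ℤ) ≡ k
          sum-back = solve-∀

      piece⇒region : ∀ {k i x} → Piece k i x → Region s ε k x
      piece⇒region {i = i} {x} (_ , m , j , refl , (l , cell) , p) = l′ , cell′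
        where
        l′ : L (+ (m ℕ.+ j)) x
        l′ = subst (λ t → L t x) (degree (+ m) (+ j))
          (L-cong (λ f → restore (x f) (+ m) (π f)) (L-combine 1ℤ (+ m) l (ind-L μ)))
          where
          degree : ∀ m j → 1ℤ ℤ.* j ℤ.+ m ℤ.* 1ℤ ≡ m ℤ.+ j
          degree = solve-∀

        x′-off : ∀ f → π f ≡ 0ℤ → sub x (+ m) π f ≡ x f
        x′-off f z = trans (cong (λ p → x f ℤ.- + m ℤ.* p) z) (sub-by-0 (x f) (+ m))

        cell′ : ∀ f → Cell s (x f) (ε f)
        cell′ f with ind-cases μ f
        cell′ f | inj₁ z with cell f
        ... | inj₁ (zc , zx) = inj₁ ((λ j → trans (sym (pivot-off i f z j)) (ε′-zero zc j)) , trans (sym (x′-off f z)) zx)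
        ... | inj₂ (nz , q)  = inj₂
          ( (λ zc → nz (zero-ε′ λ j → trans (pivot-off i f z j) (zc j)))
          , pos-cong (ext-cong (x′-off f z) (pivot-off i f z)) (ext-pos⁺ {v = pivot i f} (c·pivot i f) q) )
        -- A perturbed entry over π is the positive minimum plus a nonnegative remainder.
        cell′ f | inj₂ (i′ , refl) = inj₂ (supp i′ , pos-cong
          (λ t → trans (cong (λ y → ext s (+ m) (ε (e i)) t ℤ.+ y) (ext-pivot-edge i x (+ m) i′ t))
                       (re-add (ext s (+ m) (ε (e i)) t) (X x (e i′) t)))
          (pos-+ p (cell′-nonNeg {f = e i′} (cell (e i′)))))
          where
          re-add : ∀ u v → u ℤ.+ (v ℤ.- u) ≡ v
          re-add = solve-∀

      piece-height : ∀ {i j} x m → Region s (ε′ i) j (sub x m π) → x (e i) ≡ m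
      piece-height {i} {j} x m reg = ℤ.i-j≡0⇒i≡j _ _ (trans (sym (sub-edge x m i))
        (region-off s (ε′ i) reg (e i) (zero-ε′ (pivot-self i))))

      piece-min : ∀ {k i} x → Piece k i x → ∀ i′ → NonNeg (λ t → X x (e i′) t ℤ.- X x (e i) t) ×
                  (Zero (λ t → X x (e i′) t ℤ.- X x (e i) t) → i Fin.≤ i′)
      piece-min {k} {i} x (ok , m , j , _ , reg@(_ , cell) , _) i′ = nn , first
        where
        nn : NonNeg (λ t → X x (e i′) t ℤ.- X x (e i) t)
        nn = nonNeg-cong
          (λ t → trans (ext-pivot-edge i x (+ m) i′ t)
            (cong (λ y → X x (e i′) t ℤ.- y) (ext-cong {v = ε (e i)} (sym (piece-height x (+ m) reg)) (λ _ → refl) t)))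
          (cell′-nonNeg {f = e i′} (cell (e i′)))
        first : Zero (λ t → X x (e i′) t ℤ.- X x (e i) t) → i Fin.≤ i′
        first z = ℕ.≮⇒≥ λ i′<i → ok i′ i′<i λ t →
          *-cancel s≢0 (ℤ.i-j≡0⇒i≡j _ _ (z (suc t)))

      -- The index can be read off from x as the first minimiser over π: the two inequalities make
      -- the perturbed entries equal, and then `Ok` bounds each index by the other.
      piece-disjoint : ∀ {k i i′ x y} → Piece k i x → Piece k i′ y → x ≗ y → i ≡ i′
      piece-disjoint {k} {i} {i′} {x} {y} p q eq = Fin.≤-antisym
        (proj₂ (piece-min x p i′) z)
        (proj₂ (piece-min y q i) λ t → trans (rephrase i i′ t) (cong ℤ.-_ (z t)))
        where
        anti : ∀ u v → v ℤ.- u ≡ ℤ.- (u ℤ.- v)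
        anti = solve-∀
        rephrase : ∀ i i′ t → X y (e i) t ℤ.- X y (e i′) t ≡ ℤ.- (X x (e i′) t ℤ.- X x (e i) t)
        rephrase i i′ t = trans (cong₂ ℤ._-_ (ext-cong {v = ε (e i)} (sym (eq (e i))) (λ _ → refl) t)
                                             (ext-cong {v = ε (e i′)} (sym (eq (e i′))) (λ _ → refl) t))
                                (anti (X x (e i′) t) (X x (e i) t))
        z : Zero (λ t → X x (e i′) t ℤ.- X x (e i) t)
        z = nonNeg-antisym (proj₁ (piece-min x p i′)) (nonNeg-cong (rephrase i i′) (proj₁ (piece-min y q i)))

      -- A piece stripped of `Ok` and of the sign condition, so that m ranges over all naturals. The
      -- pieces closed and open at the start of the ray both derive from it.
      Ray : Fin r → ℕ → (E → ℤ) → Set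
      Ray i k x = ∃ λ m → ∃ λ j → m ℕ.+ j ≡ k × Region s (ε′ i) j (sub x (+ m) π)

      ray-resp : ∀ i k → Respects (Ray i k)
      ray-resp i k eq (m , j , d , reg) =
        m , j , d , region-resp s (ε′ i) j (λ f → cong (ℤ._- + m ℤ.* π f) (eq f)) reg

      sub-suc : ∀ x m → sub (λ f → x f ℤ.- π f) (+ m) π ≗ sub x (+ suc m) π
      sub-suc x m f = sub-sub (x f) (+ m) (π f)

      ray-suc⁺ : ∀ {i k x} → Region s (ε′ i) (suc k) x ⊎ Ray i k (λ f → x f ℤ.- π f) → Ray i (suc k) x
      ray-suc⁺ {i} {k} {x} (inj₁ reg) =
        0 , suc k , refl , region-resp s (ε′ i) (suc k) (λ f → sym (sub-0 (x f) (π f))) reg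
      ray-suc⁺ {i} {k} {x} (inj₂ (m , j , d , reg)) =
        suc m , j , cong suc d , region-resp s (ε′ i) j (sub-suc x m) reg

      ray-suc⁻ : ∀ {i k x} → Ray i (suc k) x → Region s (ε′ i) (suc k) x ⊎ Ray i k (λ f → x f ℤ.- π f)
      ray-suc⁻ {i} {k} {x} (zero , j , refl , reg) =
        inj₁ (region-resp s (ε′ i) (suc k) (λ f → sub-0 (x f) (π f)) reg)
      ray-suc⁻ {i} {k} {x} (suc m , j , refl , reg) = 
        inj₂ (m , j , refl , region-resp s (ε′ i) j (sym ∘ sub-suc x m) reg)

      -- Either m = 0, or one copy of π can be removed and the degree drops by 1. The two cases
      -- exclude each other because m is the entry at `e i`.
      card-ray : ∀ i {g} → (∀ j → Card (Region s (ε′ i) j) (g j)) → ∀ k → Card (Ray i k) (accumulate g k)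
      card-ray i card zero = card-cong
        (λ {x} reg → 0 , 0 , refl , region-resp s (ε′ i) 0 (λ f → sym (sub-0 (x f) (π f))) reg)
        (λ { {x} (zero , zero , _ , reg) → region-resp s (ε′ i) 0 (λ f → sub-0 (x f) (π f)) reg })
        (card zero)
      card-ray i card (suc k) = card-cong ray-suc⁺ ray-suc⁻
        (card-⊎ disjoint (card (suc k)) (card-translate π (ray-resp i k) (card-ray i card k)))
        where
        disjoint : ∀ {x y} → Region s (ε′ i) (suc k) x → Ray i k (λ f → y f ℤ.- π f) → x ≗ y → ⊥
        disjoint {x} {y} reg (m , j , _ , reg′) eq = absurd
          (trans (sym height) (cong₂ ℤ._-_ (trans (sym (eq (e i))) bottom) (ind-edge μ i)))
          where
          bottom : x (e i) ≡ 0ℤ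
          bottom = region-off s (ε′ i) reg (e i) (zero-ε′ (pivot-self i))
          height : y (e i) ℤ.- π (e i) ≡ + m
          height = piece-height (λ f → y f ℤ.- π f) (+ m) reg′
          absurd : + m ≢ 0ℤ ℤ.- 1ℤ
          absurd ()

      card-closed : ∀ {i g} → Ok i → Pos (λ j → s ℤ.* ε (e i) j) → (∀ j → Card (Region s (ε′ i) j) (g j)) →
                    ∀ k → Card (Piece k i) (accumulate g k)
      card-closed {i} ok p card k = card-cong
        (λ { (m , j , d , reg) → ok , m , j , d , reg , lift m })
        (λ { (_ , m , j , d , reg , _) → m , j , d , reg })
        (card-ray i card k)
        where
        lift : ∀ m → Pos (ext s (+ m) (ε (e i)))
        lift zero    = there refl p
        lift (suc m) = here (ℤ.+<+ ℕ.z<s)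

      open-zero : ∀ {i} → Pos (λ j → ℤ.- (s ℤ.* ε (e i) j)) → Card (Piece 0 i) 0
      open-zero p = card-empty λ { (_ , zero , zero , _ , _ , here (ℤ.+<+ ()))
                                      ; (_ , zero , zero , _ , _ , there _ q) → pos-asym q p }

      open-suc : ∀ {i g} → Ok i → Pos (λ j → ℤ.- (s ℤ.* ε (e i) j)) → (∀ j → Card (Region s (ε′ i) j) (g j)) →
                      ∀ k → Card (Piece (suc k) i) (accumulate g k)
      open-suc {i} ok p card k = card-cong
        (λ {x} → to x)
        (λ {x} → from x)
        (card-translate π (ray-resp i k) (card-ray i card k))
        where
        to : ∀ x → Ray i k (λ f → x f ℤ.- π f) → Piece (suc k) i x
        to x (m , j , d , reg) =
          ok , suc m , j , cong suc d , region-resp s (ε′ i) j (sub-suc x m) reg , here (ℤ.+<+ ℕ.z<s)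
        from : ∀ x → Piece (suc k) i x → Ray i k (λ f → x f ℤ.- π f)
        from x (_ , zero , _ , _ , _ , here (ℤ.+<+ ()))
        from x (_ , zero , _ , _ , _ , there _ q) = contradiction p (pos-asym q)
        from x (_ , suc m , j , refl , reg , _) =
          m , j , refl , region-resp s (ε′ i) j (sym ∘ sub-suc x m) reg

      count-closed : ∀ {i} → Ok i → Pos (λ j → s ℤ.* ε (e i) j) →
                     ∀ as → (∀ j → Card (Region s (ε′ i) j) (total n as j)) →
                     ∀ k → Card (Piece k i) (total (suc n) as k)
      count-closed ok p as card k = subst (Card _) (accumulate-total n as k) (card-closed ok p card k)

      -- A negative infinitesimal rules out m = 0. The ray then starts at π, of degree 1, which
      -- multiplies the numerator by t.
      count-open : ∀ {i} → Ok i → Pos (λ j → ℤ.- (s ℤ.* ε (e i) j)) →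
                   ∀ as → (∀ j → Card (Region s (ε′ i) j) (total n as j)) →
                   ∀ k → Card (Piece k i) (total (suc n) (List.map suc as) k)
      count-open ok p as card zero    = subst (Card _) (sym (total-shift-zero (suc n) as)) (open-zero p)
      count-open ok p as card (suc k) = subst (Card _)
        (trans (accumulate-total n as k) (sym (total-shift (suc n) as k))) (open-suc ok p card k)

  val : Sign → ℤ
  val s = s ℤ.◃ 1

  val≢0 : ∀ s → val s ≢ 0ℤ
  val≢0 Sign.+ ()
  val≢0 Sign.- ()

  side : Sign → ℕ × ℕ → ℕ
  side Sign.+ = proj₁
  side Sign.- = proj₂

  -- A ray that is closed for one sign of ε is open for the opposite one, so the new factor t goes
  -- to the side opposite to the orientation.
  bump : Sign → ℕ × ℕ → ℕ × ℕ
  bump Sign.+ (a , b) = a , suc b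
  bump Sign.- (a , b) = suc a , b

  bump-balanced : ∀ {n} σ {l} → proj₁ l ℕ.+ proj₂ l ≡ n → proj₁ (bump σ l) ℕ.+ proj₂ (bump σ l) ≡ suc n
  bump-balanced Sign.+ {a , b} eq = trans (ℕ.+-suc a b) (cong suc eq)
  bump-balanced Sign.- eq = cong suc eq

  orientation : ∀ {n} (v : Fin n → ℤ) → ¬ Zero v → ∃ λ σ → Pos (λ j → val σ ℤ.* v j)
  orientation v nz with trichotomy v
  ... | inj₁ p        = Sign.+ , pos-cong (λ j → sym (ℤ.*-identityˡ (v j))) p
  ... | inj₂ (inj₁ z) = contradiction z nz
  ... | inj₂ (inj₂ p) = Sign.- , pos-cong (λ j → sym (ℤ.-1*i≡-i (v j))) p

  -- A leaf (a , b) is a half-open unimodular cone with generating function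
  -- tᵃ / (1 - t)ⁿ, which becomes tᵇ / (1 - t)ⁿ when ε changes sign.
  record Counts (n : ℕ) (P : Sign → ℕ → (E → ℤ) → Set) : Set where
    field
      leaves   : List (ℕ × ℕ)
      balanced : All (λ l → proj₁ l ℕ.+ proj₂ l ≡ n) leaves
      count    : ∀ s k → Card (P s k) (total n (List.map (side s) leaves) k)

  open Counts

  gather : ∀ {n m} (P : Fin m → Sign → ℕ → (E → ℤ) → Set) →
           (∀ {i j s k x y} → P i s k x → P j s k y → x ≗ y → i ≡ j) →
           (∀ i → Counts n (P i)) → Counts n (λ s k x → ∃ λ i → P i s k x)
  gather {n} {zero}  P disjoint cs = record
    { leaves = [] ; balanced = [] ; count = λ s k → card-empty λ () }
  gather {n} {suc m} P disjoint cs = record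
    { leaves = leaves (cs zero) List.++ leaves rest
    ; balanced = All.++⁺ (balanced (cs zero)) (balanced rest)
    ; count = λ s k → subst (Card _)
        (sym (trans (cong (λ ls → total n ls k) (List.map-++ (side s) (leaves (cs zero)) (leaves rest)))
                    (total-++ n (List.map (side s) (leaves (cs zero))) _ k)))
        (card-cong [ (λ p → zero , p) , (λ { (i , p) → suc i , p }) ]′
                   (λ { (zero , p) → inj₁ p ; (suc i , p) → inj₂ (i , p) })
                   (card-⊎ (λ { p (i , q) eq → contradiction (disjoint p q eq) λ () })
                           (count (cs zero) s k) (count rest s k)))
    }
    where
    rest : Counts n (λ s k x → ∃ λ i → P (suc i) s k x)
    rest = gather (P ∘ suc) (λ p q eq → Fin.suc-injective (disjoint p q eq)) (cs ∘ suc)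

  counts-cong : ∀ {n P Q} → (∀ {s k x} → P s k x → Q s k x) → (∀ {s k x} → Q s k x → P s k x) →
                Counts n P → Counts n Q
  counts-cong to from c = record
    { leaves = leaves c ; balanced = balanced c ; count = λ s k → card-cong to from (count c s k) }

  counts-empty : ∀ {n P} → (∀ {s k x} → ¬ P s k x) → Counts n P
  counts-empty ¬p = record { leaves = [] ; balanced = [] ; count = λ s k → card-empty ¬p }

  Regions : ∀ {n} → (E → Fin n → ℤ) → Sign → ℕ → (E → ℤ) → Set
  Regions ε s = Region (val s) ε

  generator-nonempty : Generator → ∃ λ r′ → r ≡ suc r′
  generator-nonempty μ = go r refl
    where
    go : ∀ r″ → r ≡ r″ → ∃ λ r′ → r ≡ suc r′
    go (suc r′) eq = r′ , eq
    go zero     eq = contradiction (L-trivial (ind-L μ) off) λ ()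
      where
      off : ∀ f → ind μ f ≡ 0ℤ
      off f with ind-cases μ f
      ... | inj₁ z       = z
      ... | inj₂ (i , _) = contradiction (subst Fin eq i) Fin.¬Fin0

  -- Vectors without coordinates are zero, hence all cells are eliminated and only the origin is
  -- left: a cone of dimension 0 for either sign.
  counts-zero : (ε : E → Fin 0 → ℤ) → Counts 0 (Regions ε)
  counts-zero ε = record
    { leaves = (0 , 0) ∷ [] ; balanced = refl ∷ [] ; count = cnt }
    where
    origin : ∀ s → Card (Regions ε s 0) 1
    origin s = card-singleton {x = λ _ → 0ℤ} (L-0 , λ f → inj₁ ((λ ()) , refl))
      λ reg f → region-off (val s) ε reg f λ ()
    empty : ∀ s k → Card (Regions ε s (suc k)) 0
    empty s k = card-empty λ { reg@(l , _) →
      contradiction (L-trivial l λ f → region-off (val s) ε reg f λ ()) λ () }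
    cnt : ∀ s k → Card (Regions ε s k) (total 0 (List.map (side s) ((0 , 0) ∷ [])) k)
    cnt Sign.+ zero    = origin Sign.+
    cnt Sign.- zero    = origin Sign.-
    cnt Sign.+ (suc k) = empty Sign.+ k
    cnt Sign.- (suc k) = empty Sign.- k

  module _ {n} (ε : E → Fin (suc n) → ℤ) (fr : Frame ε) where

    Supported : Generator → Set
    Supported μ = ∀ i → ¬ Zero (ε (edge μ i))

    -- Either a nonzero element of the region is supported on some generator,
    -- or the origin lies in the region; in the latter case all s ε f are
    -- nonnegative, and the leading coordinate of s ε is such an element.
    regions-empty : ¬ ∃ Supported → ∀ {s k x} → ¬ Regions ε s k x
    regions-empty none {s} {suc k} {x} reg@(l , _) with generated l (region-nonNeg (val s) ε reg)
    ... | μ , p = none (μ , λ i z → ℤ.<⇒≢ (p i) (sym (region-off (val s) ε reg (edge μ i) z)))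
    regions-empty none {s} {zero} {x} reg@(l , cells) with coordinate fr zero
    ... | h , lh = go (val s ℤ.* h) refl (L-nonNeg lead lead-nonNeg)
      where
      lead : L (val s ℤ.* h) (λ f → val s ℤ.* ε f zero)
      lead = subst (λ t → L t _) (simplify (val s) h)
        (L-cong (λ f → simplify (val s) (ε f zero)) (L-combine (val s) 0ℤ lh lh))
        where
        simplify : ∀ s u → s ℤ.* u ℤ.+ 0ℤ ℤ.* u ≡ s ℤ.* u
        simplify = solve-∀
      lead-nonNeg : ∀ f → 0ℤ ℤ.≤ val s ℤ.* ε f zero
      lead-nonNeg f with cells f
      ... | inj₁ (z , _) = ℤ.≤-reflexive (sym (trans (cong (val s ℤ.*_) (z zero)) (ℤ.*-zeroʳ (val s))))
      ... | inj₂ (_ , here p) =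
        contradiction (L-zero l (region-nonNeg (val s) ε reg) f) (ℤ.<⇒≢ p ∘ sym)
      ... | inj₂ (_ , there _ p) = nonNeg-head (inj₁ p)
      go : ∀ t → t ≡ val s ℤ.* h → 0ℤ ℤ.≤ t → ⊥
      go (+ suc k) eq _ with generated (subst (λ t → L t _) (sym eq) lead) lead-nonNeg
      ... | μ , p = none (μ , λ i z →
        ℤ.<⇒≢ (p i) (sym (trans (cong (val s ℤ.*_) (z zero)) (ℤ.*-zeroʳ (val s)))))
      go (+ zero) eq _ = contradiction (independent fr δ δ-orth zero) λ ()
        where
        δ : Fin (suc n) → ℤ
        δ zero    = 1ℤ
        δ (suc _) = 0ℤ
        vanish : ∀ f → ε f zero ≡ 0ℤ
        vanish f = *-zero (val≢0 s) (L-zero (subst (λ t → L t _) (sym eq) lead) lead-nonNeg f)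
        δ-orth : ∀ f → δ · ε f ≡ 0ℤ
        δ-orth f = cong₂ ℤ._+_ (trans (ℤ.*-identityˡ (ε f zero)) (vanish f)) (·-zeroˡ (ε f ∘ suc) (λ _ → refl))

    -- The generator, the test `Ok` and the orientation of a cell are all determined by ε before s
    -- is mentioned. Both signs thus share their leaves, and this is the source of reciprocity.
    counts-suc : (∀ ε′ → Frame ε′ → Counts n (Regions ε′)) → Counts (suc n) (Regions ε)
    counts-suc rec with search {Q = λ f → ¬ Zero (ε f)} (λ f → ¬? (zero? (ε f)))
    ... | no none = counts-empty (regions-empty none)
    ... | yes (μ , supp) = counts-cong
      (λ { {s} (_ , p) → Pieces.piece⇒region (val s) (val≢0 s) p })
      (λ { {s} → Pieces.region⇒piece (val s) (val≢0 s) (proj₂ (generator-nonempty μ)) })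
      (gather (λ i s k → Pieces.Piece (val s) (val≢0 s) k i)
        (λ { {s = s} → Pieces.piece-disjoint (val s) (val≢0 s) }) piece-counts)
      where
      open Step ε fr μ supp

      piece-counts : ∀ i → Counts (suc n) (λ s k → Pieces.Piece (val s) (val≢0 s) k i)
      piece-counts i with ok? i
      ... | no ¬ok = counts-empty λ { (ok , _) → ¬ok ok }
      ... | yes ok with orientation (ε (edge μ i)) (supp i)
      ...   | σ , p = record
        { leaves   = List.map (bump σ) ls
        ; balanced = All.map⁺ (All.map (bump-balanced σ) (balanced sub-counts))
        ; count    = cnt σ p }
        where
        sub-counts = rec (ε′ i) (frame′ i)
        ls = leaves sub-counts
        closed = λ s p → Pieces.count-closed (val s) (val≢0 s) {i} ok p (List.map (side s) ls) (count sub-counts s)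
        opened = λ s p → Pieces.count-open (val s) (val≢0 s) {i} ok p (List.map (side s) ls) (count sub-counts s)
        cnt : ∀ σ → Pos (λ j → val σ ℤ.* ε (edge μ i) j) → ∀ s k →
              Card (Pieces.Piece (val s) (val≢0 s) k i) (total (suc n) (List.map (side s) (List.map (bump σ) ls)) k)
        cnt Sign.+ p Sign.+ k = subst (λ as → Card _ (total (suc n) as k)) (List.map-∘ ls) (closed Sign.+ p k)
        cnt Sign.- p Sign.- k = subst (λ as → Card _ (total (suc n) as k)) (List.map-∘ ls) (closed Sign.- p k)
        cnt Sign.+ p Sign.- k = subst (λ as → Card _ (total (suc n) as k))
          (trans (sym (List.map-∘ ls)) (List.map-∘ ls)) (opened Sign.- (pos-cong (λ j → flip₊ (ε (edge μ i) j)) p) k)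
          where
          flip₊ : ∀ u → 1ℤ ℤ.* u ≡ ℤ.- (-1ℤ ℤ.* u)
          flip₊ = solve-∀
        cnt Sign.- p Sign.+ k = subst (λ as → Card _ (total (suc n) as k))
          (trans (sym (List.map-∘ ls)) (List.map-∘ ls)) (opened Sign.+ (pos-cong (λ j → flip₋ (ε (edge μ i) j)) p) k)
          where
          flip₋ : ∀ u → -1ℤ ℤ.* u ≡ ℤ.- (1ℤ ℤ.* u)
          flip₋ = solve-∀

  decompose : ∀ n (ε : E → Fin n → ℤ) → Frame ε → Counts n (Regions ε)
  decompose zero    ε fr = counts-zero ε
  decompose (suc n) ε fr = counts-suc ε fr (decompose n)

-- Perfect matchings by augmenting paths

module Hall where
  sum-mono : ∀ {n} {f g : Fin n → ℕ} → (∀ i → f i ℕ.≤ g i) → ∑ℕ.sum f ℕ.≤ ∑ℕ.sum g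
  sum-mono {zero}  le = ℕ.z≤n
  sum-mono {suc n} le = ℕ.+-mono-≤ (le zero) (sum-mono (le ∘ suc))

  term≤sum : ∀ {n} (f : Fin n → ℕ) i → f i ℕ.≤ ∑ℕ.sum f
  term≤sum f zero    = ℕ.m≤m+n _ _
  term≤sum f (suc i) = ℕ.≤-trans (term≤sum (f ∘ suc) i) (ℕ.m≤n+m _ _)

  sum≡0⇒≡0 : ∀ {n} (f : Fin n → ℕ) → ∑ℕ.sum f ≡ 0 → ∀ i → f i ≡ 0
  sum≡0⇒≡0 f eq i = ℕ.n≤0⇒n≡0 (subst (f i ℕ.≤_) eq (term≤sum f i))

  indicator : ∀ {P : Set} → Dec P → ℕ
  indicator (yes _) = 1
  indicator (no _)  = 0

  indicator-yes : ∀ {P : Set} (P? : Dec P) → P → indicator P? ≡ 1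
  indicator-yes (yes _) p = refl
  indicator-yes (no ¬p) p = contradiction p ¬p

  indicator-no : ∀ {P : Set} (P? : Dec P) → ¬ P → indicator P? ≡ 0
  indicator-no (yes p) ¬p = contradiction p ¬p
  indicator-no (no _)  ¬p = refl

  sum-zero : ∀ {n} (f : Fin n → ℕ) → (∀ i → f i ≡ 0) → ∑ℕ.sum f ≡ 0
  sum-zero {n} f z = trans (∑ℕ.sum-cong-≗ z) (∑ℕ.sum-replicate-zero n)

  sum-unique : ∀ {n} (f : Fin n → ℕ) i → (∀ j → j ≢ i → f j ≡ 0) → ∑ℕ.sum f ≡ f i
  sum-unique f zero z = trans (cong (f zero ℕ.+_) (sum-zero (f ∘ suc) λ j → z (suc j) λ ())) (ℕ.+-identityʳ _)
  sum-unique f (suc i) z =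
    cong₂ ℕ._+_ (z zero λ ()) (sum-unique (f ∘ suc) i λ j j≢i → z (suc j) (j≢i ∘ Fin.suc-injective))

  -- Every column carrying weight is charged to a row of weight 1 matched with it; exchanging the
  -- sums collects the charges row by row.
  covering : ∀ {m n} (f : Fin n → ℕ) (w : Fin m → ℕ) (μ : Fin m → Fin n) →
             (∀ j → f j ≢ 0 → ∃ λ i → w i ≡ 1 × μ i ≡ j) → ∑ℕ.sum f ℕ.≤ ∑ℕ.sum (λ i → w i ℕ.* f (μ i))
  covering f w μ cover = begin
    ∑ℕ.sum f                                                             ≤⟨ sum-mono term ⟩
    ∑ℕ.sum (λ j → ∑ℕ.sum λ i → w i ℕ.* (indicator (μ i Fin.≟ j) ℕ.* f j))   ≡⟨ ∑ℕ.∑-comm (λ j i → w i ℕ.* (indicator (μ i Fin.≟ j) ℕ.* f j)) ⟩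
    ∑ℕ.sum (λ i → ∑ℕ.sum λ j → w i ℕ.* (indicator (μ i Fin.≟ j) ℕ.* f j))   ≡⟨ ∑ℕ.sum-cong-≗ collapse ⟩
    ∑ℕ.sum (λ i → w i ℕ.* f (μ i))                                       ∎
    where
    open ℕ.≤-Reasoning
    term : ∀ j → f j ℕ.≤ ∑ℕ.sum λ i → w i ℕ.* (indicator (μ i Fin.≟ j) ℕ.* f j)
    term j with f j ℕ.≟ 0
    ... | yes z = ℕ.≤-trans (ℕ.≤-reflexive z) ℕ.z≤n
    ... | no nz with cover j nz
    ...   | i , wi , eq = ℕ.≤-trans
      (ℕ.≤-reflexive (sym (trans (cong₂ (λ a b → a ℕ.* (b ℕ.* f j)) wi (indicator-yes (μ i Fin.≟ j) eq))
        (trans (ℕ.*-identityˡ _) (ℕ.*-identityˡ _)))))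
      (term≤sum (λ i → w i ℕ.* (indicator (μ i Fin.≟ j) ℕ.* f j)) i)
    collapse : ∀ i → ∑ℕ.sum (λ j → w i ℕ.* (indicator (μ i Fin.≟ j) ℕ.* f j)) ≡ w i ℕ.* f (μ i)
    collapse i = trans
      (sum-unique _ (μ i) λ j j≢ → trans
        (cong (λ b → w i ℕ.* (b ℕ.* f j)) (indicator-no (μ i Fin.≟ j) (j≢ ∘ sym))) (ℕ.*-zeroʳ (w i)))
      (cong (w i ℕ.*_) (trans (cong (ℕ._* f (μ i)) (indicator-yes (μ i Fin.≟ μ i) refl)) (ℕ.*-identityˡ _)))

  module Augment {m n} (M : Fin m → Fin n → ℕ) where

    PerfectMatching : Set
    PerfectMatching = ∃ λ μ → (∀ i → M i (μ i) ≢ 0) × Injective _≡_ _≡_ μ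

    -- The map μ stays total, and row h counts as unmatched whatever value μ takes there.
    record MatchingExcept (h : Fin m) (μ : Fin m → Fin n) : Set where
      field
        supported : ∀ {i} → i ≢ h → M i (μ i) ≢ 0
        injective : ∀ {i i′} → i ≢ h → i′ ≢ h → μ i ≡ μ i′ → i ≡ i′

    open MatchingExcept

    -- An alternating path from h, recorded by its rows: the column matched to each new row is
    -- adjacent to the row before. Freshness keeps the path simple, so rematching its last row
    -- leaves the rest of it intact.
    data Trail (μ : Fin m → Fin n) (h : Fin m) : Fin m → List (Fin m) → Set where
      start  : Trail μ h h []
      extend : ∀ {i i′ vs} → Trail μ h i vs → All (i′ ≢_) (i ∷ vs) → i′ ≢ h → M i (μ i′) ≢ 0 →
               Trail μ h i′ (i ∷ vs)

    trail-cong : ∀ {μ μ′ h i vs} → All (λ v → μ′ v ≡ μ v) (i ∷ vs) → Trail μ h i vs → Trail μ′ h i vs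
    trail-cong eqs start = start
    trail-cong (eq ∷ eqs) (extend {i} t fresh ≢h nz) =
      extend (trail-cong eqs t) fresh ≢h (subst (λ j → M i j ≢ 0) (sym eq) nz)

    -- The trail is consumed from its far end: its last row moves to the free
    -- column, which frees the column its predecessor is adjacent to.
    augment : ∀ {μ h i vs j} → MatchingExcept h μ → Trail μ h i vs →
              (∀ {i′} → i′ ≢ h → μ i′ ≢ j) → M i j ≢ 0 → PerfectMatching
    augment {μ} {h} {j = j} match start free nz = μ′ , supp , inj
      where
      μ′ = updateAt μ h (const j)
      at-h : μ′ h ≡ j
      at-h = updateAt-updates h μ
      off-h : ∀ {i} → i ≢ h → μ′ i ≡ μ i
      off-h {i} ne = updateAt-minimal i h μ ne
      supp : ∀ i → M i (μ′ i) ≢ 0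
      supp i with i Fin.≟ h
      ... | yes refl = subst (λ j → M i j ≢ 0) (sym at-h) nz
      ... | no ne    = subst (λ j → M i j ≢ 0) (sym (off-h ne)) (supported match ne)
      inj : Injective _≡_ _≡_ μ′
      inj {i} {i′} eq with i Fin.≟ h | i′ Fin.≟ h
      ... | yes refl | yes refl = refl
      ... | yes refl | no ne    = contradiction (trans (sym (off-h ne)) (trans (sym eq) at-h)) (free ne)
      ... | no ne    | yes refl = contradiction (trans (sym (off-h ne)) (trans eq at-h)) (free ne)
      ... | no ne    | no ne′   = injective match ne ne′ (trans (sym (off-h ne)) (trans eq (off-h ne′)))
    augment {μ} {h} {i′} {j = j} match (extend {i} t fresh i′≢h nz′) free nz =
      augment match′ (trail-cong (All.map (λ ne → off (ne ∘ sym)) fresh) t) free′ nz′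
      where
      μ′ = updateAt μ i′ (const j)
      at : μ′ i′ ≡ j
      at = updateAt-updates i′ μ
      off : ∀ {v} → v ≢ i′ → μ′ v ≡ μ v
      off {v} ne = updateAt-minimal v i′ μ ne
      match′ : MatchingExcept h μ′
      match′ = record { supported = supp ; injective = inj }
        where
        supp : ∀ {v} → v ≢ h → M v (μ′ v) ≢ 0
        supp {v} v≢h with v Fin.≟ i′
        ... | yes refl = subst (λ j → M v j ≢ 0) (sym at) nz
        ... | no ne    = subst (λ j → M v j ≢ 0) (sym (off ne)) (supported match v≢h)
        inj : ∀ {u v} → u ≢ h → v ≢ h → μ′ u ≡ μ′ v → u ≡ v
        inj {u} {v} u≢h v≢h eq with u Fin.≟ i′ | v Fin.≟ i′
        ... | yes refl | yes refl = refl
        ... | yes refl | no ne    = contradiction (trans (sym (off ne)) (trans (sym eq) at)) (free v≢h)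
        ... | no ne    | yes refl = contradiction (trans (sym (off ne)) (trans eq at)) (free u≢h)
        ... | no ne    | no ne′   = injective match u≢h v≢h (trans (sym (off ne)) (trans eq (off ne′)))
      free′ : ∀ {v} → v ≢ h → μ′ v ≢ μ i′
      free′ {v} v≢h eq with v Fin.≟ i′
      ... | yes refl = free i′≢h (trans (sym eq) at)
      ... | no ne    = ne (injective match v≢h i′≢h (trans (sym (off ne)) eq))

    module _ {k} (rows : ∀ i → ∑ℕ.sum (M i) ≡ suc k) (cols : ∀ j → ∑ℕ.sum (λ i → M i j) ℕ.≤ suc k)
             {h μ} (match : MatchingExcept h μ) where

      -- Double counting: the rows of S carry weight (k+1) ∣S∣, while their
      -- columns are matched to S ∖ {h} and carry at most (k+1) (∣S∣ - 1).
      ¬closed : ∀ (S : Subset m) → h ∈ S →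
                (∀ {i} → i ∈ S → ∀ j → M i j ≢ 0 → ∃ λ i′ → (i′ ∈ S × i′ ≢ h) × μ i′ ≡ j) → ⊥
      ¬closed S h∈S closed = ℕ.<⇒≱ smaller (begin
        suc k ℕ.* ∑ℕ.sum χ                                    ≡⟨ ∑ℕ.*-distribˡ-sum (suc k) χ ⟩
        ∑ℕ.sum (λ i → suc k ℕ.* χ i)                          ≡⟨ ∑ℕ.sum-cong-≗ (λ i → trans (ℕ.*-comm (suc k) (χ i)) (cong (χ i ℕ.*_) (sym (rows i)))) ⟩
        ∑ℕ.sum (λ i → χ i ℕ.* ∑ℕ.sum (M i))                      ≤⟨ sum-mono row ⟩
        ∑ℕ.sum (λ i → ∑ℕ.sum λ i′ → χ′ i′ ℕ.* M i (μ i′))        ≡⟨ ∑ℕ.∑-comm (λ i i′ → χ′ i′ ℕ.* M i (μ i′)) ⟩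
        ∑ℕ.sum (λ i′ → ∑ℕ.sum λ i → χ′ i′ ℕ.* M i (μ i′))        ≡⟨ ∑ℕ.sum-cong-≗ (λ i′ → ∑ℕ.*-distribˡ-sum (χ′ i′) (λ i → M i (μ i′))) ⟨
        ∑ℕ.sum (λ i′ → χ′ i′ ℕ.* ∑ℕ.sum λ i → M i (μ i′))        ≤⟨ sum-mono (λ i′ → ℕ.*-monoʳ-≤ (χ′ i′) (cols (μ i′))) ⟩
        ∑ℕ.sum (λ i′ → χ′ i′ ℕ.* suc k)                       ≡⟨ ∑ℕ.*-distribʳ-sum (suc k) χ′ ⟨
        ∑ℕ.sum χ′ ℕ.* suc k                                   ≡⟨ ℕ.*-comm (∑ℕ.sum χ′) (suc k) ⟩
        suc k ℕ.* ∑ℕ.sum χ′                                   ∎)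
        where
        open ℕ.≤-Reasoning
        inside? : ∀ i → Dec (i ∈ S × i ≢ h)
        inside? i = (i Subset.∈? S) ×-dec ¬? (i Fin.≟ h)
        χ χ′ : Fin m → ℕ
        χ i = indicator (i Subset.∈? S)
        χ′ i = indicator (inside? i)
        row : ∀ i → χ i ℕ.* ∑ℕ.sum (M i) ℕ.≤ ∑ℕ.sum (λ i′ → χ′ i′ ℕ.* M i (μ i′))
        row i with i Subset.∈? S
        ... | no _  = ℕ.z≤n
        ... | yes i∈S = ℕ.≤-trans (ℕ.≤-reflexive (ℕ.*-identityˡ _)) (covering (M i) χ′ μ λ j nz →
              let (i′ , ins , eq) = closed i∈S j nz in i′ , indicator-yes (inside? i′) ins , eq)
        split : ∀ i → χ i ≡ indicator (i Fin.≟ h) ℕ.+ χ′ i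
        split i with i Subset.∈? S | i Fin.≟ h
        ... | yes _  | yes _    = refl
        ... | yes _  | no _     = refl
        ... | no i∉S | yes refl = contradiction h∈S i∉S
        ... | no _   | no _     = refl
        size : ∑ℕ.sum χ ≡ suc (∑ℕ.sum χ′)
        size = trans (∑ℕ.sum-cong-≗ split) (trans (∑ℕ.∑-distrib-+ (λ i → indicator (i Fin.≟ h)) χ′)
          (cong (ℕ._+ ∑ℕ.sum χ′) (trans (sum-unique _ h λ j ne → indicator-no (j Fin.≟ h) ne) (indicator-yes (h Fin.≟ h) refl))))
        smaller : suc k ℕ.* ∑ℕ.sum χ′ ℕ.< suc k ℕ.* ∑ℕ.sum χ
        smaller = ℕ.*-monoʳ-< (suc k) (ℕ.≤-reflexive (sym size))

      Reached : Subset m → Set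
      Reached S = ∀ {i} → i ∈ S → ∃ λ vs → All (_∈ S) (i ∷ vs) × Trail μ h i vs

      -- S collects rows reachable from h by alternating paths. A free column adjacent to S permits
      -- augmentation, an adjacent column matched outside S enlarges S, and otherwise S contradicts
      -- `¬closed`. The fuel bounds the number of rows still outside S.
      explore : ∀ fuel (S : Subset m) → m ℕ.≤ fuel ℕ.+ Subset.∣ S ∣ → h ∈ S → Reached S → PerfectMatching
      explore fuel S bound h∈S reached
        with Fin.any? (λ i → (i Subset.∈? S) ×-dec Fin.any? λ j → ¬? (M i j ℕ.≟ 0) ×-dec
               Fin.all? λ i′ → ¬? (i′ Fin.≟ h) →-dec ¬? (μ i′ Fin.≟ j))
           | Fin.any? (λ i → (i Subset.∈? S) ×-dec Fin.any? λ i′ → ¬? (i′ Subset.∈? S) ×-dec ¬? (M i (μ i′) ℕ.≟ 0))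
      ... | yes (i , i∈S , j , nz , free) | _ =
        augment match (proj₂ (proj₂ (reached i∈S))) (λ {i′} → free i′) nz
      ... | no noFree | no noNew = ⊥-elim (¬closed S h∈S closed)
        where
        closed : ∀ {i} → i ∈ S → ∀ j → M i j ≢ 0 → ∃ λ i′ → (i′ ∈ S × i′ ≢ h) × μ i′ ≡ j
        closed {i} i∈S j nz with Fin.any? (λ i′ → ¬? (i′ Fin.≟ h) ×-dec (μ i′ Fin.≟ j))
        ... | no none = contradiction (i , i∈S , j , nz , λ i′ ne eq → none (i′ , ne , eq)) noFree
        ... | yes (i′ , ne , refl) with i′ Subset.∈? S
        ...   | yes i′∈S = i′ , (i′∈S , ne) , refl
        ...   | no  i′∉S = contradiction (i , i∈S , i′ , i′∉S , nz) noNew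
      explore zero S bound h∈S reached | no _ | yes (i , _ , i′ , i′∉S , _) =
        contradiction (subst (i′ ∈_) (sym full) Subset.∈⊤) i′∉S
        where
        full : S ≡ Subset.⊤
        full = Subset.∣p∣≡n⇒p≡⊤ (ℕ.≤-antisym (Subset.∣p∣≤n S) bound)
      explore (suc fuel) S bound h∈S reached | no _ | yes (i , i∈S , i′ , i′∉S , nz) =
        explore fuel (S ∪ ⁅ i′ ⁆)
          (ℕ.≤-trans bound (ℕ.≤-trans (ℕ.≤-reflexive (sym (ℕ.+-suc fuel Subset.∣ S ∣))) (ℕ.+-monoʳ-≤ fuel grown)))
          (old h∈S) reached′
        where
        old : ∀ {v} → v ∈ S → v ∈ S ∪ ⁅ i′ ⁆
        old = Subset.p⊆p∪q ⁅ i′ ⁆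
        new : i′ ∈ S ∪ ⁅ i′ ⁆
        new = Subset.q⊆p∪q S ⁅ i′ ⁆ (Subset.x∈⁅x⁆ i′)
        grown : Subset.∣ S ∣ ℕ.< Subset.∣ S ∪ ⁅ i′ ⁆ ∣
        grown = Subset.p⊂q⇒∣p∣<∣q∣ (old , i′ , new , i′∉S)
        fresh : ∀ {v} → v ∈ S → i′ ≢ v
        fresh v∈S refl = i′∉S v∈S
        reached′ : Reached (S ∪ ⁅ i′ ⁆)
        reached′ v∈ with Subset.x∈p∪q⁻ S ⁅ i′ ⁆ v∈
        ... | inj₁ v∈S = let (vs , inS , t) = reached v∈S in vs , All.map old inS , t
        ... | inj₂ v∈i′ with Subset.x∈⁅y⁆⇒x≡y i′ v∈i′ | reached i∈S
        ...   | refl | vs , inS , t =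
          i ∷ vs , new ∷ All.map old inS , extend t (All.map fresh inS) (fresh h∈S ∘ λ eq → eq) nz

  open Augment

  -- Induction on the rows. Removing a row preserves the other row sums but may lower column sums,
  -- hence the inequality for the columns.
  matching : ∀ {m n k} (M : Fin m → Fin n → ℕ) → (∀ i → ∑ℕ.sum (M i) ≡ suc k) →
             (∀ j → ∑ℕ.sum (λ i → M i j) ℕ.≤ suc k) → PerfectMatching M
  matching {zero}  M rows cols = (λ ()) , (λ ()) , λ { {()} }
  matching {suc m} {zero}  M rows cols = contradiction (rows zero) λ ()
  matching {suc m} {suc n} {k} M rows cols
    with matching (M ∘ suc) (rows ∘ suc) (λ j → ℕ.≤-trans (ℕ.m≤n+m _ (M zero j)) (cols j))
  ... | μ , supp , inj = explore M rows cols {zero} match (suc m) ⁅ zero ⁆ (ℕ.m≤m+n _ _) (Subset.x∈⁅x⁆ zero) reached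
    where
    μ⁺ : Fin (suc m) → Fin (suc n)
    -- A placeholder, since row `zero` is the one still to be matched.
    μ⁺ zero    = zero
    μ⁺ (suc i) = μ i
    match : MatchingExcept M zero μ⁺
    match = record
      { supported = λ { {zero} ne → contradiction refl ne ; {suc i} _ → supp i }
      ; injective = λ { {zero} ne _ _ → contradiction refl ne
                      ; {suc _} {zero} _ ne _ → contradiction refl ne
                      ; {suc i} {suc i′} _ _ eq → cong suc (inj eq) } }
    reached : Reached M rows cols match ⁅ zero ⁆
    reached i∈ with Subset.x∈⁅y⁆⇒x≡y zero i∈
    ... | refl = [] , i∈ ∷ [] , start

-- Finite sums of integers

open Hall hiding (sum-zero; sum-unique)

sum-zero : ∀ {n} (f : Fin n → ℤ) → (∀ i → f i ≡ 0ℤ) → sum f ≡ 0ℤ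
sum-zero {n} f z = trans (sum-cong-≗ z) (sum-replicate-zero n)

sum-unique : ∀ {n} (f : Fin n → ℤ) i → (∀ j → j ≢ i → f j ≡ 0ℤ) → sum f ≡ f i
sum-unique f zero z = trans (cong (λ t → f zero ℤ.+ t) (sum-zero (f ∘ suc) λ j → z (suc j) λ ())) (ℤ.+-identityʳ _)
sum-unique f (suc i) z =
  trans (cong₂ ℤ._+_ (z zero λ ()) (sum-unique (f ∘ suc) i λ j j≢i → z (suc j) (j≢i ∘ Fin.suc-injective)))
        (ℤ.+-identityˡ _)

sum-linear : ∀ {n} p (f : Fin n → ℤ) q g →
             sum (λ i → p ℤ.* f i ℤ.+ q ℤ.* g i) ≡ p ℤ.* sum f ℤ.+ q ℤ.* sum g
sum-linear p f q g = trans (∑-distrib-+ (λ i → p ℤ.* f i) (λ i → q ℤ.* g i))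
  (sym (cong₂ ℤ._+_ (*-distribˡ-sum p f) (*-distribˡ-sum q g)))

sum-fromℕ : ∀ {n} (f : Fin n → ℕ) → sum (λ i → + f i) ≡ + ∑ℕ.sum f
sum-fromℕ {zero}  f = refl
sum-fromℕ {suc n} f = cong (λ t → + f zero ℤ.+ t) (sum-fromℕ (f ∘ suc))

sum-const : ∀ n k → sum {n} (λ _ → k) ≡ + n ℤ.* k
sum-const zero    k = sym (ℤ.*-zeroˡ k)
sum-const (suc n) k = trans (cong (λ t → k ℤ.+ t) (sum-const n k)) (sym (ℤ.suc-* (+ n) k))

sum-nonNeg : ∀ {n} (f : Fin n → ℤ) → (∀ i → 0ℤ ℤ.≤ f i) → 0ℤ ℤ.≤ sum f
sum-nonNeg {zero}  f p = ℤ.≤-refl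
sum-nonNeg {suc n} f p = ℤ.+-mono-≤ (p zero) (sum-nonNeg (f ∘ suc) (p ∘ suc))

sum-++ : ∀ m {n} (f : Fin (m ℕ.+ n) → ℤ) → sum f ≡ sum (λ i → f (i ↑ˡ n)) ℤ.+ sum (λ i → f (m ↑ʳ i))
sum-++ zero    f = sym (ℤ.+-identityˡ _)
sum-++ (suc m) f = trans (cong (λ t → f zero ℤ.+ t) (sum-++ m (f ∘ suc))) (sym (ℤ.+-assoc (f zero) _ _))

sum-combine : ∀ m {n} (f : Fin (m ℕ.* n) → ℤ) → sum f ≡ sum {m} (λ i → sum {n} (λ j → f (combine i j)))
sum-combine zero    f = refl
sum-combine (suc m) {n} f = trans (sum-++ n f) (cong (λ t → sum (λ j → f (j ↑ˡ (m ℕ.* n))) ℤ.+ t) (sum-combine m (λ i → f (n ↑ʳ i))))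

injective⇒hits : ∀ {n} (μ : Fin n → Fin n) → Injective _≡_ _≡_ μ → ∀ j → ∃ λ i → μ i ≡ j
injective⇒hits {suc n} μ inj j with Fin.any? (λ i → μ i Fin.≟ j)
... | yes hit = hit
... | no miss = contradiction (Fin.injective⇒≤ {f = λ i → punchOut (j≢μ i)}
                  λ {i} {i′} eq → inj (Fin.punchOut-injective (j≢μ i) (j≢μ i′) eq)) ℕ.1+n≰n
  where
  j≢μ : ∀ i → j ≢ μ i
  j≢μ i eq = miss (i , sym eq)

-- The cone of magic squares

module MagicCone (d : ℕ) where

  private
    n = suc d
    E = Fin n × Fin n

  record Magic (k : ℤ) (x : E → ℤ) : Set where
    constructor _,_
    field
      rows : ∀ i → sum (λ j → x (i , j)) ≡ k
      columns : ∀ j → sum (λ i → x (i , j)) ≡ k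

  Transversal : Set
  Transversal = ∃ λ (μ : Fin n → Fin n) → Injective _≡_ _≡_ μ

  permutationMatrix : Transversal → E → ℤ
  permutationMatrix (μ , _) (i , j) = + indicator (μ i Fin.≟ j)

  permutationMatrix-magic : ∀ μ → Magic 1ℤ (permutationMatrix μ)
  permutationMatrix-magic (μ , inj) = row , col
    where
    row : ∀ i → sum (λ j → + indicator (μ i Fin.≟ j)) ≡ 1ℤ
    row i = trans (sum-unique _ (μ i) λ j ne → cong +_ (indicator-no (μ i Fin.≟ j) (ne ∘ sym)))
                  (cong +_ (indicator-yes (μ i Fin.≟ μ i) refl))
    col : ∀ j → sum (λ i → + indicator (μ i Fin.≟ j)) ≡ 1ℤ
    col j with injective⇒hits μ inj j
    ... | i , refl = trans (sum-unique _ i λ i′ ne → cong +_ (indicator-no (μ i′ Fin.≟ μ i) (ne ∘ inj)))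
                           (cong +_ (indicator-yes (μ i Fin.≟ μ i) refl))

  -- Exhaustion: the maps from rows to columns are coded by `Fin (n ^ n)`, and injectivity is
  -- decidable for each code.
  search : ∀ {Q : E → Set} → (∀ f → Dec (Q f)) → Dec (∃ λ (μ : Transversal) → ∀ i → Q (i , proj₁ μ i))
  search {Q} Q? = map′
    (λ { (c , inj , q) → (finToFun c , λ {i} {j} → inj i j) , q })
    (λ { ((μ , inj) , q) → funToFin μ
       , (λ i j eq → inj (trans (sym (Fin.finToFun-funToFin μ i)) (trans eq (Fin.finToFun-funToFin μ j))))
       , λ i → subst (λ j → Q (i , j)) (sym (Fin.finToFun-funToFin μ i)) (q i) })
    (Fin.any? λ (c : Fin (n ℕ.^ n)) →
      Fin.all? (λ i → Fin.all? λ j → (finToFun {n} {n} c i Fin.≟ finToFun {n} {n} c j) →-dec (i Fin.≟ j))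
      ×-dec Fin.all? λ i → Q? (i , finToFun {n} {n} c i))

  generated : ∀ {k x} → Magic (+ suc k) x → (∀ f → 0ℤ ℤ.≤ x f) →
              ∃ λ (μ : Transversal) → ∀ i → 0ℤ ℤ.< x (i , proj₁ μ i)
  generated {k} {x} (rows , cols) nn with matching M rowsM (ℕ.≤-reflexive ∘ colsM)
    where
    M : Fin n → Fin n → ℕ
    M i j = ℤ.∣ x (i , j) ∣
    +M : ∀ i j → + M i j ≡ x (i , j)
    +M i j = ℤ.0≤i⇒+∣i∣≡i (nn (i , j))
    rowsM : ∀ i → ∑ℕ.sum (M i) ≡ suc k
    rowsM i = ℤ.+-injective (trans (sym (sum-fromℕ (M i))) (trans (sum-cong-≗ (+M i)) (rows i)))
    colsM : ∀ j → ∑ℕ.sum (λ i → M i j) ≡ suc k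
    colsM j = ℤ.+-injective (trans (sym (sum-fromℕ λ i → M i j)) (trans (sum-cong-≗ λ i → +M i j) (cols j)))
  ... | μ , supp , inj = (μ , inj) , λ i → ℤ.≤∧≢⇒< (nn (i , μ i)) λ eq → supp i (cong ℤ.∣_∣ (sym eq))

  magicCone : Cone E n
  magicCone = record
    { L = Magic
    ; L-cong = λ eq (rows , cols) →
        (λ i → trans (sum-cong-≗ λ j → sym (eq (i , j))) (rows i)) ,
        (λ j → trans (sum-cong-≗ λ i → sym (eq (i , j))) (cols j))
    ; L-combine = λ {k} {l} {x} {y} p q (rows , cols) (rows′ , cols′) →
        (λ i → trans (sum-linear p (λ j → x (i , j)) q (λ j → y (i , j)))
                     (cong₂ (λ s t → p ℤ.* s ℤ.+ q ℤ.* t) (rows i) (rows′ i))) ,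
        (λ j → trans (sum-linear p (λ i → x (i , j)) q (λ i → y (i , j)))
                     (cong₂ (λ s t → p ℤ.* s ℤ.+ q ℤ.* t) (cols j) (cols′ j)))
    ; L-0 = (λ _ → sum-zero {n} _ λ _ → refl) , (λ _ → sum-zero {n} _ λ _ → refl)
    ; L-nonNeg = λ {k} {x} (rows , _) nn → subst (0ℤ ℤ.≤_) (rows zero) (sum-nonNeg (λ j → x (zero , j)) (λ j → nn (zero , j)))
    ; L-zero = λ {x} (rows , _) nn (i , j) → vanish (λ j → x (i , j)) (λ j → nn (i , j)) (rows i) j
    ; L-trivial = λ {k} {x} (rows , _) z → trans (sym (rows zero)) (sum-zero (λ j → x (zero , j)) (λ j → z (zero , j)))
    ; Generator = Transversal
    ; edge = λ μ i → i , proj₁ μ i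
    ; ind = permutationMatrix
    ; ind-L = permutationMatrix-magic
    ; ind-edge = λ (μ , _) i → cong +_ (indicator-yes (μ i Fin.≟ μ i) refl)
    ; ind-cases = λ { (μ , _) (i , j) → cases μ i j }
    ; search = search
    ; generated = generated
    }
    where
    vanish : ∀ {m} (f : Fin m → ℤ) → (∀ i → 0ℤ ℤ.≤ f i) → sum f ≡ 0ℤ → ∀ i → f i ≡ 0ℤ
    vanish f nn eq i = trans (sym (ℤ.0≤i⇒+∣i∣≡i (nn i))) (cong +_ (sum≡0⇒≡0 (ℤ.∣_∣ ∘ f) (ℤ.+-injective
      (trans (sym (sum-fromℕ (ℤ.∣_∣ ∘ f))) (trans (sum-cong-≗ (λ i → ℤ.0≤i⇒+∣i∣≡i (nn i))) eq))) i))
    cases : ∀ (μ : Fin n → Fin n) i j → + indicator (μ i Fin.≟ j) ≡ 0ℤ ⊎ ∃ λ i′ → (i , j) ≡ (i′ , μ i′)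
    cases μ i j with μ i Fin.≟ j
    ... | yes refl = inj₂ (i , refl)
    ... | no _     = inj₁ refl

  open Decomposition magicCone

  -- The vectors e_{a+1} - e₀ span the zero-sum vectors.
  difference : Fin d → Fin n → ℤ
  difference a zero    = -1ℤ
  difference a (suc i) = + indicator (a Fin.≟ i)

  difference-sum : ∀ a → sum (difference a) ≡ 0ℤ
  difference-sum a = cong (λ t → -1ℤ ℤ.+ t) (trans
    (sum-unique _ a λ i ne → cong +_ (indicator-no (a Fin.≟ i) (ne ∘ sym)))
    (cong +_ (indicator-yes (a Fin.≟ a) refl)))

  difference-expand : ∀ (z : Fin n → ℤ) → sum z ≡ 0ℤ → ∀ i → z i ≡ sum (λ a → z (suc a) ℤ.* difference a i)
  difference-expand z eq (suc i) = sym (trans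
    (sum-unique _ i λ a ne → trans (cong (λ t → z (suc a) ℤ.* + t) (indicator-no (a Fin.≟ i) ne)) (ℤ.*-zeroʳ (z (suc a))))
    (trans (cong (λ t → z (suc i) ℤ.* + t) (indicator-yes (i Fin.≟ i) refl)) (ℤ.*-identityʳ _)))
  difference-expand z eq zero = trans (solve-head (z zero) (sum (z ∘ suc)) eq) (*-distribʳ-sum -1ℤ (z ∘ suc))
    where
    solve-head : ∀ a b → a ℤ.+ b ≡ 0ℤ → a ≡ b ℤ.* -1ℤ
    solve-head a b eq = trans (rearrange a b) (trans (cong (λ t → t ℤ.+ b ℤ.* -1ℤ) eq) (ℤ.+-identityˡ _))
      where
      rearrange : ∀ a b → a ≡ (a ℤ.+ b) ℤ.+ b ℤ.* -1ℤ
      rearrange = solve-∀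

  -- The leading coordinate is the all-ones square, so that every ε f is positive;
  -- the others form a basis of the squares of size d + 1 with zero line sums.
  frame : E → Fin (suc (d ℕ.* d)) → ℤ
  frame f       zero    = 1ℤ
  frame (i , j) (suc t) = let (a , b) = remQuot d t in difference a i ℤ.* difference b j

  degree : Fin (suc (d ℕ.* d)) → ℤ
  degree zero    = + n
  degree (suc _) = 0ℤ

  frame-coordinate : ∀ t → Magic (degree t) (λ f → frame f t)
  frame-coordinate zero    = (λ _ → ones) , (λ _ → ones)
    where
    ones : sum {n} (λ _ → 1ℤ) ≡ + n
    ones = trans (sum-const n 1ℤ) (ℤ.*-identityʳ (+ n))
  frame-coordinate (suc t) =
    (λ i → trans (sym (*-distribˡ-sum (difference a i) (difference b)))
      (trans (cong (difference a i ℤ.*_) (difference-sum b)) (ℤ.*-zeroʳ (difference a i)))) ,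
    (λ j → trans (sym (*-distribʳ-sum (difference b j) (difference a)))
      (trans (cong (ℤ._* difference b j) (difference-sum a)) (ℤ.*-zeroˡ (difference b j))))
    where
    a = proj₁ (remQuot {d} d t)
    b = proj₂ (remQuot {d} d t)

  frame-independent : ∀ c → (∀ f → c · frame f ≡ 0ℤ) → Zero c
  frame-independent c orth = λ { zero → c₀ ; (suc t) → cₜ t }
    where
    open ≡-Reasoning
    -- Summing the relation along one row isolates the all-ones coordinate, as all others have zero
    -- line sums.
    c₀ : c zero ≡ 0ℤ
    c₀ = *-zero {+ n} (λ ()) (begin
      + n ℤ.* c zero                                        ≡⟨ ℤ.*-comm (+ n) (c zero) ⟩
      c zero ℤ.* + n                                        ≡⟨ ℤ.+-identityʳ _ ⟨
      c zero ℤ.* + n ℤ.+ 0ℤ                                 ≡⟨ cong (λ t → c zero ℤ.* + n ℤ.+ t) (·-zeroʳ (c ∘ suc) (λ _ → refl)) ⟨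
      c · degree                                            ≡⟨ sum-cong-≗ (λ t → cong (c t ℤ.*_) (Magic.rows (frame-coordinate t) zero)) ⟨
      sum (λ t → c t ℤ.* sum (λ j → frame (zero , j) t))    ≡⟨ sum-cong-≗ (λ t → *-distribˡ-sum (c t) (λ j → frame (zero , j) t)) ⟩
      sum (λ t → sum (λ j → c t ℤ.* frame (zero , j) t))    ≡⟨ ∑-comm (λ t j → c t ℤ.* frame (zero , j) t) ⟩
      sum (λ j → c · frame (zero , j))                      ≡⟨ sum-zero (λ j → c · frame (zero , j)) (λ j → orth (zero , j)) ⟩
      0ℤ                                                    ∎)
    -- At the cell (a + 1, b + 1) the only product of differences that does not vanish is the one
    -- with index (a, b).
    cₜ : ∀ t → c (suc t) ≡ 0ℤ
    cₜ t = begin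
      c (suc t)                                             ≡⟨ ℤ.*-identityʳ _ ⟨
      c (suc t) ℤ.* 1ℤ                                      ≡⟨ cong (c (suc t) ℤ.*_) diagonal ⟨
      c (suc t) ℤ.* entry t                                 ≡⟨ sum-unique (λ t′ → c (suc t′) ℤ.* entry t′) t
                                                                 (λ t′ ne → trans (cong (c (suc t′) ℤ.*_) (off-diagonal t′ ne)) (ℤ.*-zeroʳ (c (suc t′)))) ⟨
      sum (λ t′ → c (suc t′) ℤ.* entry t′)                  ≡⟨ ℤ.+-identityˡ _ ⟨
      0ℤ ℤ.+ sum (λ t′ → c (suc t′) ℤ.* entry t′)           ≡⟨ cong (ℤ._+ sum (λ t′ → c (suc t′) ℤ.* entry t′)) (trans (ℤ.*-identityʳ (c zero)) c₀) ⟨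
      c · frame (suc a , suc b)                             ≡⟨ orth (suc a , suc b) ⟩
      0ℤ                                                    ∎
      where
      a = proj₁ (remQuot {d} d t)
      b = proj₂ (remQuot {d} d t)
      entry : Fin (d ℕ.* d) → ℤ
      entry t′ = frame (suc a , suc b) (suc t′)
      diagonal : entry t ≡ 1ℤ
      diagonal = cong₂ (λ u v → + u ℤ.* + v) (indicator-yes (a Fin.≟ a) refl) (indicator-yes (b Fin.≟ b) refl)
      off-diagonal : ∀ t′ → t′ ≢ t → entry t′ ≡ 0ℤ
      off-diagonal t′ ne = go (proj₁ (remQuot {d} d t′) Fin.≟ a) (proj₂ (remQuot {d} d t′) Fin.≟ b)
        where
        go : Dec (proj₁ (remQuot {d} d t′) ≡ a) → Dec (proj₂ (remQuot {d} d t′) ≡ b) → entry t′ ≡ 0ℤ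
        go (no p) _ = trans (cong (λ u → + u ℤ.* difference (proj₂ (remQuot {d} d t′)) (suc b)) (indicator-no (_ Fin.≟ a) p)) (ℤ.*-zeroˡ (difference (proj₂ (remQuot {d} d t′)) (suc b)))
        go (yes _) (no q) = trans (cong (λ v → difference (proj₁ (remQuot {d} d t′)) (suc a) ℤ.* + v) (indicator-no (_ Fin.≟ b) q)) (ℤ.*-zeroʳ (difference (proj₁ (remQuot {d} d t′)) (suc a)))
        go (yes p) (yes q) = contradiction
          (trans (sym (Fin.combine-remQuot {d} d t′)) (trans (cong₂ combine p q) (Fin.combine-remQuot {d} d t))) ne

  frame-spanning : ∀ {k x} → Magic k x → ∃ λ c → ∀ f → + n ℤ.* x f ≡ c · frame f
  frame-spanning {k} {x} (rows , cols) = c , span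
    where
    open ≡-Reasoning
    -- The factor n lets the mean k / n be subtracted from each entry without fractions. What
    -- remains has zero line sums and is expanded in differences along the rows and then along the
    -- columns.
    y : Fin n → Fin n → ℤ
    y i j = + n ℤ.* x (i , j) ℤ.+ -1ℤ ℤ.* k
    line-zero : ∀ (z : Fin n → ℤ) → sum z ≡ k → sum (λ j → + n ℤ.* z j ℤ.+ -1ℤ ℤ.* k) ≡ 0ℤ
    line-zero z eq = begin
      sum (λ j → + n ℤ.* z j ℤ.+ -1ℤ ℤ.* k)           ≡⟨ sum-linear (+ n) z -1ℤ (λ _ → k) ⟩
      + n ℤ.* sum z ℤ.+ -1ℤ ℤ.* sum {n} (λ _ → k)     ≡⟨ cong₂ (λ s t → + n ℤ.* s ℤ.+ -1ℤ ℤ.* t) eq (sum-const n k) ⟩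
      + n ℤ.* k ℤ.+ -1ℤ ℤ.* (+ n ℤ.* k)               ≡⟨ cancel (+ n) k ⟩
      0ℤ                                              ∎
      where
      cancel : ∀ n k → n ℤ.* k ℤ.+ -1ℤ ℤ.* (n ℤ.* k) ≡ 0ℤ
      cancel = solve-∀
    c : Fin (suc (d ℕ.* d)) → ℤ
    c zero    = k
    c (suc t) = let (a , b) = remQuot {d} d t in y (suc a) (suc b)
    term : Fin n → Fin n → Fin d × Fin d → ℤ
    term i j (a , b) = y (suc a) (suc b) ℤ.* (difference a i ℤ.* difference b j)
    expand : ∀ i j → sum (λ t → term i j (remQuot {d} d t)) ≡ y i j
    expand i j = begin
      sum (λ t → term i j (remQuot {d} d t))                          ≡⟨ sum-combine d {d} (λ t → term i j (remQuot {d} d t)) ⟩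
      sum (λ a → sum λ b → term i j (remQuot {d} d (combine {d} {d} a b)))    ≡⟨ sum-cong-≗ (λ a → sum-cong-≗ λ b → cong (term i j) (Fin.remQuot-combine {d} a b)) ⟩
      sum (λ a → sum λ b → term i j (a , b))                          ≡⟨ sum-cong-≗ (λ a → sum-cong-≗ λ b → regroup (y (suc a) (suc b)) (difference a i) (difference b j)) ⟩
      sum (λ a → sum λ b → (y (suc a) (suc b) ℤ.* difference b j) ℤ.* difference a i)
        ≡⟨ sum-cong-≗ (λ a → *-distribʳ-sum (difference a i) (λ b → y (suc a) (suc b) ℤ.* difference b j)) ⟨
      sum (λ a → sum (λ b → y (suc a) (suc b) ℤ.* difference b j) ℤ.* difference a i)
        ≡⟨ sum-cong-≗ (λ a → cong (ℤ._* difference a i) (difference-expand (y (suc a)) (line-zero (λ j → x (suc a , j)) (rows (suc a))) j)) ⟨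
      sum (λ a → y (suc a) j ℤ.* difference a i)                      ≡⟨ difference-expand (λ i → y i j) (line-zero (λ i → x (i , j)) (cols j)) i ⟨
      y i j                                                           ∎
      where
      regroup : ∀ y u v → y ℤ.* (u ℤ.* v) ≡ (y ℤ.* v) ℤ.* u
      regroup = solve-∀
    span : ∀ f → + n ℤ.* x f ≡ c · frame f
    span (i , j) = begin
      + n ℤ.* x (i , j)                                         ≡⟨ restore (+ n ℤ.* x (i , j)) k ⟩
      k ℤ.* 1ℤ ℤ.+ y i j                                        ≡⟨ cong (λ t → k ℤ.* 1ℤ ℤ.+ t) (expand i j) ⟨
      k ℤ.* 1ℤ ℤ.+ sum (λ t → term i j (remQuot {d} d t))       ∎
      where
      restore : ∀ u k → u ≡ k ℤ.* 1ℤ ℤ.+ (u ℤ.+ -1ℤ ℤ.* k)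
      restore = solve-∀

  frame-isFrame : Frame frame
  frame-isFrame = record
    { independent = frame-independent
    ; spanning    = λ l _ → + n , (λ ()) , frame-spanning l
    ; coordinate  = λ t → degree t , frame-coordinate t }

  toMatrix : ∀ {k} → MagicSquare n k → E → ℤ
  toMatrix (M , _) (i , j) = + Vec.lookup (Vec.lookup M i) j

  lookup-transpose : ∀ {p q} (M : Vec (Vec ℕ p) q) j → Vec.lookup (transpose M) j ≡ Vec.map (λ row → Vec.lookup row j) M
  lookup-transpose []        j = Vec.lookup-replicate j []
  lookup-transpose {p} (row ∷ M) j = begin
    Vec.lookup ((Vec.replicate p Vec._∷_ Vec.⊛ row) Vec.⊛ transpose M) j
      ≡⟨ Vec.lookup-⊛ j (Vec.replicate p Vec._∷_ Vec.⊛ row) (transpose M) ⟩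
    Vec.lookup (Vec.replicate p Vec._∷_ Vec.⊛ row) j (Vec.lookup (transpose M) j)
      ≡⟨ cong₂ (λ (f : Vec ℕ _ → Vec ℕ _) v → f v) (trans (Vec.lookup-⊛ j (Vec.replicate p Vec._∷_) row)
           (cong (λ (f : ℕ → Vec ℕ _ → Vec ℕ _) → f (Vec.lookup row j)) (Vec.lookup-replicate j Vec._∷_))) (lookup-transpose M j) ⟩
    Vec.lookup row j ∷ Vec.map (λ row → Vec.lookup row j) M ∎
    where open ≡-Reasoning

  sum-lookup : ∀ {m} (v : Vec ℕ m) → sum (λ i → + Vec.lookup v i) ≡ + Vec.sum v
  sum-lookup []      = refl
  sum-lookup (x ∷ v) = cong (λ t → + x ℤ.+ t) (sum-lookup v)

  column-sum : ∀ {p q} (M : Vec (Vec ℕ p) q) j →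
               sum (λ i → + Vec.lookup (Vec.lookup M i) j) ≡ + Vec.sum (Vec.lookup (transpose M) j)
  column-sum M j = trans (sum-cong-≗ λ i → cong +_ (sym (Vec.lookup-map i (λ row → Vec.lookup row j) M)))
    (trans (sum-lookup (Vec.map (λ row → Vec.lookup row j) M)) (cong (+_ ∘ Vec.sum) (sym (lookup-transpose M j))))

  toMatrix-magic : ∀ {k} (M : MagicSquare n k) → Magic (+ k) (toMatrix M)
  toMatrix-magic (M , rows , cols) =
    (λ i → trans (sum-lookup (Vec.lookup M i)) (cong +_ (VecAll.lookup⁺ rows i))) ,
    (λ j → trans (column-sum M j) (cong +_ (VecAll.lookup⁺ cols j)))

  lookup-ext : ∀ {A : Set} {m} {u v : Vec A m} → (∀ i → Vec.lookup u i ≡ Vec.lookup v i) → u ≡ v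
  lookup-ext {u = []}    {[]}    eq = refl
  lookup-ext {u = x ∷ u} {y ∷ v} eq = cong₂ _∷_ (eq zero) (lookup-ext (eq ∘ suc))

  toMatrix-injective : ∀ {k} {M M′ : MagicSquare n k} → toMatrix M ≗ toMatrix M′ → M ≡ M′
  toMatrix-injective {k} {M , p} {M′ , p′} eq
    with lookup-ext {u = M} {M′} (λ i → lookup-ext (λ j → ℤ.+-injective (eq (i , j))))
  ... | refl = cong (M ,_) (cong₂ _,_ (VecAll.irrelevant ℕ.≡-irrelevant _ _) (VecAll.irrelevant ℕ.≡-irrelevant _ _))

  record NonNegMagic (k : ℕ) (x : E → ℤ) : Set where
    constructor _,_
    field
      magic  : Magic (+ k) x
      nonNeg : ∀ f → 0ℤ ℤ.≤ x f

  fromMatrix : ∀ {k x} → NonNegMagic k x → ∃ λ (M : MagicSquare n k) → x ≗ toMatrix M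
  fromMatrix {k} {x} ((rows , cols) , nn) = (M , VecAll.lookup⁻ rowsM , VecAll.lookup⁻ colsM) , entry
    where
    M : SquareMatrix n
    M = Vec.tabulate λ i → Vec.tabulate λ j → ℤ.∣ x (i , j) ∣
    entry : ∀ f → x f ≡ + Vec.lookup (Vec.lookup M (proj₁ f)) (proj₂ f)
    entry (i , j) = trans (sym (ℤ.0≤i⇒+∣i∣≡i (nn (i , j)))) (cong +_ (sym (trans
      (cong (λ v → Vec.lookup v j) (Vec.lookup∘tabulate (λ i → Vec.tabulate λ j → ℤ.∣ x (i , j) ∣) i))
      (Vec.lookup∘tabulate (λ j → ℤ.∣ x (i , j) ∣) j))))
    rowsM : ∀ i → Vec.sum (Vec.lookup M i) ≡ k
    rowsM i = ℤ.+-injective (trans (sym (sum-lookup (Vec.lookup M i)))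
      (trans (sum-cong-≗ λ j → sym (entry (i , j))) (rows i)))
    colsM : ∀ j → Vec.sum (Vec.lookup (transpose M) j) ≡ k
    colsM j = ℤ.+-injective (trans (sym (column-sum M j)) (trans (sum-cong-≗ λ i → sym (entry (i , j))) (cols j)))

  card-magic : ∀ k → Card (NonNegMagic k) (H n k)
  card-magic k = record
    { elem     = toMatrix ∘ to
    ; sound    = λ i → toMatrix-magic (to i) , λ _ → ℤ.+≤+ ℕ.z≤n
    ; distinct = λ {i} {j} eq → trans (sym (strictlyInverseʳ i)) (trans (cong from (toMatrix-injective eq)) (strictlyInverseʳ j))
    ; complete = λ p → let (M , eq) = fromMatrix p in
        from M , λ f → trans (eq f) (cong (λ S → toMatrix S f) (sym (strictlyInverseˡ M)))
    }
    where open Inverse (H-counts n k)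

  private
    frame≢0 : ∀ f → ¬ Zero (frame f)
    frame≢0 f z = contradiction (z zero) λ ()

  -- The leading infinitesimal is 1 in every cell, so with positive sign an entry 0 already counts
  -- as positive.
  card-closed-region : ∀ k → Card (Regions frame Sign.+ k) (H n k)
  card-closed-region k = card-cong
    (λ { {x} (l , nn) → l , λ f → inj₂ (frame≢0 f , cell (x f) f (nn f)) })
    (λ { reg@(l , _) → l , region-nonNeg 1ℤ frame reg })
    (card-magic k)
    where
    cell : ∀ m f → 0ℤ ℤ.≤ m → Pos (ext 1ℤ m (frame f))
    cell (+ zero)  f _ = there refl (here (ℤ.+<+ ℕ.z<s))
    cell (+ suc m) f _ = here (ℤ.+<+ ℕ.z<s)

  open-cell : ∀ (x : E → ℤ) f → Cell -1ℤ (x f) (frame f) → 0ℤ ℤ.< x f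
  open-cell x f (inj₁ (z , _)) = contradiction z (frame≢0 f)
  open-cell x f (inj₂ (_ , here p)) = p
  open-cell x f (inj₂ (_ , there _ (here ())))
  open-cell x f (inj₂ (_ , there _ (there () _)))

  card-open-region : ∀ k → Card (Regions frame Sign.- (n ℕ.+ k)) (H n k)
  card-open-region k = card-cong
    (λ {x} (l , nn) →
      (Cone.L-cong magicCone (λ f → restore (x f)) (raise l))
      , λ f → inj₂ (frame≢0 f , here (subst (0ℤ ℤ.<_) (restore (x f)) (positive (nn f)))))
    (λ { {x} (l , cells) → lower l , λ f → ℤ.i≤j⇒0≤j-i (ℤ.i<j⇒suc[i]≤j (open-cell x f (cells f))) })
    (card-translate (λ _ → 1ℤ) (λ eq (l , nn) → Cone.L-cong magicCone eq l , λ f → subst (0ℤ ℤ.≤_) (eq f) (nn f)) (card-magic k))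
    where
    restore : ∀ u → 1ℤ ℤ.* (u ℤ.- 1ℤ) ℤ.+ 1ℤ ℤ.* 1ℤ ≡ u
    restore = solve-∀
    positive : ∀ {u} → 0ℤ ℤ.≤ u → 0ℤ ℤ.< 1ℤ ℤ.* u ℤ.+ 1ℤ ℤ.* 1ℤ
    positive {+ u} _ = subst (0ℤ ℤ.<_) (sym (trans (cong (ℤ._+ 1ℤ) (ℤ.*-identityˡ (+ u))) (cong +_ (ℕ.+-comm u 1)))) (ℤ.+<+ ℕ.z<s)
    raise : ∀ {y} → Magic (+ k) y → Magic (+ (n ℕ.+ k)) (λ f → 1ℤ ℤ.* y f ℤ.+ 1ℤ ℤ.* 1ℤ)
    raise l = subst (λ t → Magic t _) (sum-degree (+ n) (+ k)) (Cone.L-combine magicCone 1ℤ 1ℤ l (frame-coordinate zero))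
      where
      sum-degree : ∀ n k → 1ℤ ℤ.* k ℤ.+ 1ℤ ℤ.* n ≡ n ℤ.+ k
      sum-degree = solve-∀
    lower : ∀ {x} → Magic (+ (n ℕ.+ k)) x → Magic (+ k) (λ f → x f ℤ.- 1ℤ)
    lower {x} l = subst (λ t → Magic t _) (sub-degree (+ n) (+ k)) (L-sub 1ℤ l (frame-coordinate zero))
      where
      sub-degree : ∀ n k → (n ℤ.+ k) ℤ.- 1ℤ ℤ.* n ≡ k
      sub-degree = solve-∀

  card-open-region-zero : Card (Regions frame Sign.- 0) 0
  card-open-region-zero = card-empty λ { {x} reg@(l , cells) →
    ℤ.<⇒≢ (open-cell x (zero , zero) (cells _)) (sym (Cone.L-zero magicCone l (region-nonNeg -1ℤ frame reg) (zero , zero))) }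

  -- The components a of the leaves (a , b) form the h*-vector of the Birkhoff
  -- polytope, as a multiset of exponents.
  hVector : ∃ λ (ls : List (ℕ × ℕ)) → All (λ l → proj₁ l ℕ.+ proj₂ l ≡ suc (d ℕ.* d)) ls
          × (∀ k → H n k ≡ total (suc (d ℕ.* d)) (List.map proj₁ ls) k)
          × (∀ k → H n k ≡ total (suc (d ℕ.* d)) (List.map proj₂ ls) (n ℕ.+ k))
          × total (suc (d ℕ.* d)) (List.map proj₂ ls) 0 ≡ 0
  hVector = leaves , balanced
    , (λ k → card-unique (card-closed-region k) (count Sign.+ k))
    , (λ k → card-unique (card-open-region k) (count Sign.- (n ℕ.+ k)))
    , card-unique (count Sign.- 0) card-open-region-zero
    where open Counts (decompose (suc (d ℕ.* d)) frame frame-isFrame)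

-- Binomial polynomials and their reflection

coeff-binomial : ∀ D k → coeff (suc D) 0 k ≡ (k + D) C D
coeff-binomial zero    zero    = refl
coeff-binomial zero    (suc k) = coeff-binomial zero k
coeff-binomial (suc D) zero    = trans (coeff-binomial D zero) (trans (nCn≡1 D) (sym (nCn≡1 (suc D))))
coeff-binomial (suc D) (suc k) = begin
  coeff (suc D) 0 (suc k) + coeff (suc (suc D)) 0 k   ≡⟨ cong₂ _+_ (coeff-binomial D (suc k)) (coeff-binomial (suc D) k) ⟩
  suc (k + D) C D + (k + suc D) C suc D               ≡⟨ cong (λ t → suc (k + D) C D + t C suc D) (ℕ.+-suc k D) ⟩
  suc (k + D) C D + suc (k + D) C suc D               ≡⟨ nCk+nC[k+1]≡[n+1]C[k+1] (suc (k + D)) D ⟩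
  suc (suc (k + D)) C suc D                           ≡⟨ cong (λ t → suc t C suc D) (ℕ.+-suc k D) ⟨
  suc (k + suc D) C suc D                             ∎
  where open ≡-Reasoning

-- The polynomial x ↦ (x+1)(x+2)⋯(x+D) / D!, i.e. the binomial coefficient
-- C(x+D, D) for every integer x; at x = -1-m it is (-1)^D C(m, D).
risingBinomial : ℕ → ℤ → ℤ
risingBinomial D (+ x)    = + ((x + D) C D)
risingBinomial D -[1+ x ] = -1ℤ ℤ.^ D ℤ.* + (x C D)

-- For k < a the coefficient is 0, and the polynomial has its zeros exactly at -1, ..., -D. The
-- hypothesis keeps k - a above -D - 1, where the two would part.
coeff-rising : ∀ D a k → a ℕ.≤ k + D → + coeff (suc D) a k ≡ risingBinomial D (k ℤ.⊖ a)
coeff-rising D zero    k       _  = cong +_ (coeff-binomial D k)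
coeff-rising D (suc a) (suc k) le = trans (cong +_ (coeff-shift (suc D) a k))
  (trans (coeff-rising D a k (ℕ.s≤s⁻¹ le)) (cong (risingBinomial D) (sym (ℤ.[1+m]⊖[1+n]≡m⊖n k a))))
coeff-rising D (suc a) zero    le = trans (cong +_ (coeff-shift-zero (suc D) a))
  (sym (trans (cong (λ t → -1ℤ ℤ.^ D ℤ.* + t) (k>n⇒nCk≡0 le)) (ℤ.*-zeroʳ (-1ℤ ℤ.^ D))))

signs-cancel : ∀ D u → -1ℤ ℤ.^ D ℤ.* (-1ℤ ℤ.^ D ℤ.* u) ≡ u
signs-cancel zero    u = trans (ℤ.*-identityˡ _) (ℤ.*-identityˡ u)
signs-cancel (suc D) u = trans (regroup (-1ℤ ℤ.^ D) u) (signs-cancel D u)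
  where
  regroup : ∀ s u → -1ℤ ℤ.* s ℤ.* (-1ℤ ℤ.* s ℤ.* u) ≡ s ℤ.* (s ℤ.* u)
  regroup = solve-∀

-- The substitution reverses the order of the D factors x + 1, ..., x + D and negates each. At x =
-- -1-m with m < D both sides vanish; with m ≥ D the two signs cancel.
rising-reflect : ∀ D x → risingBinomial D (ℤ.- x ℤ.- + suc D) ≡ -1ℤ ℤ.^ D ℤ.* risingBinomial D x
rising-reflect D (+ zero)  = refl
rising-reflect D (+ suc m) = refl
rising-reflect D -[1+ m ]  with ℕ.≤-total D m
... | inj₁ D≤m = begin
  risingBinomial D (suc m ℤ.⊖ suc D)                        ≡⟨ cong (risingBinomial D) (trans (ℤ.[1+m]⊖[1+n]≡m⊖n m D) (ℤ.⊖-≥ D≤m)) ⟩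
  + ((m ∸ D + D) C D)                                       ≡⟨ cong (λ t → + (t C D)) (ℕ.m∸n+n≡m D≤m) ⟩
  + (m C D)                                                 ≡⟨ signs-cancel D (+ (m C D)) ⟨
  -1ℤ ℤ.^ D ℤ.* (-1ℤ ℤ.^ D ℤ.* + (m C D))                   ∎
  where open ≡-Reasoning
... | inj₂ m≤D with ℕ.m≤n⇒∃[o]m+o≡n m≤D
...   | zero , eq = trans (cong (risingBinomial D) (trans (ℤ.[1+m]⊖[1+n]≡m⊖n m D)
          (trans (cong (ℤ._⊖ D) m≡D) (ℤ.n⊖n≡0 D))))
        (trans (cong (λ t → + (t C D)) (sym m≡D)) (sym (signs-cancel D (+ (m C D)))))
  where
  m≡D : m ≡ D
  m≡D = trans (sym (ℕ.+-identityʳ m)) eq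
...   | suc o , refl = trans (cong (risingBinomial D′) negative)
          (trans (vanish o (ℕ.m≤n+m (suc o) m)) (sym (trans (cong (-1ℤ ℤ.^ D′ ℤ.*_) (vanish m (ℕ.m<m+n m ℕ.z<s))) (ℤ.*-zeroʳ (-1ℤ ℤ.^ D′)))))
  where
  D′ = m + suc o
  negative : suc m ℤ.⊖ suc D′ ≡ -[1+ o ]
  negative = trans (ℤ.[1+m]⊖[1+n]≡m⊖n m D′) (trans (ℤ.⊖-< (ℕ.m<m+n m ℕ.z<s)) (cong (λ t → ℤ.- + t) (ℕ.m+n∸m≡n m (suc o))))
  vanish : ∀ y → y ℕ.< D′ → -1ℤ ℤ.^ D′ ℤ.* + (y C D′) ≡ 0ℤ
  vanish y lt = trans (cong (λ t → -1ℤ ℤ.^ D′ ℤ.* + t) (k>n⇒nCk≡0 lt)) (ℤ.*-zeroʳ (-1ℤ ℤ.^ D′))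

-- Polynomials described by finite differences

-- Having degree below r is encoded as a vanishing r-th difference on all of ℤ. This avoids
-- coefficients and denominators, and it is the property from which the final identity follows.
data Degree< : ℕ → (ℤ → ℤ) → Set where
  null       : ∀ {g} → (∀ z → g z ≡ 0ℤ) → Degree< 0 g
  difference : ∀ {r g} → Degree< r (λ z → g (z ℤ.+ 1ℤ) ℤ.- g z) → Degree< (suc r) g

degree-cong : ∀ {r g h} → g ≗ h → Degree< r g → Degree< r h
degree-cong eq (null p)       = null (λ z → trans (sym (eq z)) (p z))
degree-cong eq (difference p) = difference (degree-cong (λ z → cong₂ ℤ._-_ (eq (z ℤ.+ 1ℤ)) (eq z)) p)

degree-0 : ∀ r → Degree< r (λ _ → 0ℤ)
degree-0 zero    = null (λ _ → refl)
degree-0 (suc r) = difference (degree-0 r)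

degree-+ : ∀ {r g h} → Degree< r g → Degree< r h → Degree< r (λ z → g z ℤ.+ h z)
degree-+ (null p) (null q) = null (λ z → cong₂ ℤ._+_ (p z) (q z))
degree-+ {g = g} {h} (difference p) (difference q) =
  difference (degree-cong (λ z → regroup (g (z ℤ.+ 1ℤ)) (g z) (h (z ℤ.+ 1ℤ)) (h z)) (degree-+ p q))
  where
  regroup : ∀ a b c d → (a ℤ.- b) ℤ.+ (c ℤ.- d) ≡ (a ℤ.+ c) ℤ.- (b ℤ.+ d)
  regroup = solve-∀

degree-shift : ∀ {r g} c → Degree< r g → Degree< r (λ z → g (z ℤ.+ c))
degree-shift c (null p) = null (λ z → p (z ℤ.+ c))
degree-shift {g = g} c (difference p) =
  difference (degree-cong (λ z → cong (λ t → g t ℤ.- g (z ℤ.+ c)) (swap z c)) (degree-shift c p))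
  where
  swap : ∀ z c → (z ℤ.+ c) ℤ.+ 1ℤ ≡ (z ℤ.+ 1ℤ) ℤ.+ c
  swap = solve-∀

degree-suc : ∀ {r g} → Degree< r g → Degree< (suc r) g
degree-suc (null p)       = difference (null λ z → cong₂ ℤ._-_ (p (z ℤ.+ 1ℤ)) (p z))
degree-suc (difference p) = difference (degree-suc p)

-- A step of length m telescopes into m translated unit steps. With it `degree-scale` treats z ↦
-- g(mz), whose unit step is a step of length m for g.
degree-difference : ∀ {r} {g : ℤ → ℤ} m → Degree< r (λ z → g (z ℤ.+ 1ℤ) ℤ.- g z) → Degree< r (λ z → g (z ℤ.+ + m) ℤ.- g z)
degree-difference {r} {g} zero p =
  degree-cong (λ z → sym (trans (cong (λ t → g t ℤ.- g z) (ℤ.+-identityʳ z)) (ℤ.+-inverseʳ (g z)))) (degree-0 r)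
degree-difference {r} {g} (suc m) p =
  degree-cong (λ z → trans (telescope (g (z ℤ.+ + m ℤ.+ 1ℤ)) (g (z ℤ.+ + m)) (g z))
                           (cong (λ t → g t ℤ.- g z) (step z (+ m))))
    (degree-+ (degree-shift {g = λ z → g (z ℤ.+ 1ℤ) ℤ.- g z} (+ m) p) (degree-difference {g = g} m p))
  where
  telescope : ∀ a b c → (a ℤ.- b) ℤ.+ (b ℤ.- c) ≡ a ℤ.- c
  telescope = solve-∀
  step : ∀ z m → z ℤ.+ m ℤ.+ 1ℤ ≡ z ℤ.+ (1ℤ ℤ.+ m)
  step = solve-∀

degree-scale : ∀ r {g} m → Degree< r g → Degree< r (λ z → g (+ m ℤ.* z))
degree-scale zero m (null p) = null (λ z → p (+ m ℤ.* z))
degree-scale (suc r) {g} m (difference p) =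
  difference (degree-cong (λ z → cong (λ t → g t ℤ.- g (+ m ℤ.* z)) (expand (+ m) z))
    (degree-scale r {λ z → g (z ℤ.+ + m) ℤ.- g z} m (degree-difference {g = g} m p)))
  where
  expand : ∀ m z → m ℤ.* z ℤ.+ m ≡ m ℤ.* (z ℤ.+ 1ℤ)
  expand = solve-∀

pascal-difference : ∀ n k → + (suc n C suc k) ℤ.- + (n C suc k) ≡ + (n C k)
pascal-difference n k = trans (cong (λ t → + t ℤ.- + (n C suc k)) (sym (nCk+nC[k+1]≡[n+1]C[k+1] n k)))
  (cancel (+ (n C k)) (+ (n C suc k)))
  where
  cancel : ∀ a b → a ℤ.+ b ℤ.- b ≡ a
  cancel = solve-∀

-- Pascal's rule on either side of the origin. At z = -1 the two branches of `risingBinomial` meet,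
-- with values 0 at -1 and 1 at 0.
rising-difference : ∀ D z → risingBinomial (suc D) (z ℤ.+ 1ℤ) ℤ.- risingBinomial (suc D) z ≡ risingBinomial D (z ℤ.+ 1ℤ)
rising-difference D (+ m) = begin
  + ((m + 1 + suc D) C suc D) ℤ.- + ((m + suc D) C suc D)
    ≡⟨ cong₂ (λ s t → + (s C suc D) ℤ.- + (t C suc D)) (lhs m D) (ℕ.+-suc m D) ⟩
  + (suc (suc (m + D)) C suc D) ℤ.- + (suc (m + D) C suc D)
    ≡⟨ pascal-difference (suc (m + D)) D ⟩
  + (suc (m + D) C D)
    ≡⟨ cong (λ t → + (t C D)) (rhs m D) ⟨
  + ((m + 1 + D) C D) ∎
  where
  open ≡-Reasoning
  lhs : ∀ m D → m + 1 + suc D ≡ suc (suc (m + D))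
  lhs = ℕSolver.solve-∀
  rhs : ∀ m D → m + 1 + D ≡ suc (m + D)
  rhs = ℕSolver.solve-∀
rising-difference D -[1+ zero ] = begin
  + (suc D C suc D) ℤ.- -1ℤ ℤ.^ suc D ℤ.* 0ℤ   ≡⟨ cong₂ (λ s t → + s ℤ.- t) (nCn≡1 (suc D)) (ℤ.*-zeroʳ (-1ℤ ℤ.^ suc D)) ⟩
  1ℤ                                           ≡⟨ cong +_ (nCn≡1 D) ⟨
  + (D C D)                                    ∎
  where open ≡-Reasoning
rising-difference D -[1+ suc m ] = begin
  -1ℤ ℤ.* s ℤ.* + (m C suc D) ℤ.- -1ℤ ℤ.* s ℤ.* + (suc m C suc D)  ≡⟨ regroup s (+ (m C suc D)) (+ (suc m C suc D)) ⟩
  s ℤ.* (+ (suc m C suc D) ℤ.- + (m C suc D))                      ≡⟨ cong (s ℤ.*_) (pascal-difference m D) ⟩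
  s ℤ.* + (m C D)                                                  ∎
  where
  open ≡-Reasoning
  s = -1ℤ ℤ.^ D
  regroup : ∀ s u v → -1ℤ ℤ.* s ℤ.* u ℤ.- -1ℤ ℤ.* s ℤ.* v ≡ s ℤ.* (v ℤ.- u)
  regroup = solve-∀

rising-degree : ∀ D → Degree< (suc D) (risingBinomial D)
rising-degree zero = difference (null λ z → cong₂ ℤ._-_ (constant (z ℤ.+ 1ℤ)) (constant z))
  where
  constant : ∀ z → risingBinomial 0 z ≡ 1ℤ
  constant (+ x)    = refl
  constant -[1+ x ] = refl
rising-degree (suc D) = difference (degree-cong (λ z → sym (rising-difference D z)) (degree-shift 1ℤ (rising-degree D)))

-- Alternating binomial sums

alternating : ℕ → (ℤ → ℤ) → ℤ → ℕ → ℤ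
alternating r g z j = -1ℤ ℤ.^ j ℤ.* + (r C j) ℤ.* g (z ℤ.- + j)

-- Σ_j (-1)^j C(r,j) g(z-j) is the r-th backward difference of g at z; the
-- summation range may exceed r because the further binomials vanish.
alternating-sum : ∀ r {g} → Degree< r g → ∀ m z → r ℕ.< m → sum {m} (λ j → alternating r g z (toℕ j)) ≡ 0ℤ
alternating-sum zero {g} (null p) m z _ = sum-zero {m} _ λ j →
  trans (cong (-1ℤ ℤ.^ toℕ j ℤ.* + (0 C toℕ j) ℤ.*_) (p (z ℤ.- + toℕ j))) (ℤ.*-zeroʳ (-1ℤ ℤ.^ toℕ j ℤ.* + (0 C toℕ j)))
alternating-sum (suc r) {g} (difference p) (suc m) z (ℕ.s≤s r<m) = begin
  w (suc r) g z 0 ℤ.+ sum {m} (λ j → w (suc r) g z (suc (toℕ j)))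
    ≡⟨ cong₂ ℤ._+_ first (sum-cong-≗ {m} λ j → pascal (toℕ j)) ⟩
  w r g z 0 ℤ.+ sum {m} (λ j → w r g z (suc (toℕ j)) ℤ.+ -1ℤ ℤ.* w r g (z ℤ.- 1ℤ) (toℕ j))
    ≡⟨ cong (λ t → w r g z 0 ℤ.+ t) (trans (∑-distrib-+ {m} (λ j → w r g z (suc (toℕ j))) (λ j → -1ℤ ℤ.* w r g (z ℤ.- 1ℤ) (toℕ j)))
         (cong (λ t → sum {m} (λ j → w r g z (suc (toℕ j))) ℤ.+ t) (sym (*-distribˡ-sum {m} -1ℤ (λ j → w r g (z ℤ.- 1ℤ) (toℕ j)))))) ⟩
  w r g z 0 ℤ.+ (sum {m} (λ j → w r g z (suc (toℕ j))) ℤ.+ -1ℤ ℤ.* sum {m} (λ j → w r g (z ℤ.- 1ℤ) (toℕ j)))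
    ≡⟨ ℤ.+-assoc (w r g z 0) _ _ ⟨
  sum {suc m} (λ j → w r g z (toℕ j)) ℤ.+ -1ℤ ℤ.* sum {m} (λ j → w r g (z ℤ.- 1ℤ) (toℕ j))
    ≡⟨ cong (λ t → sum {suc m} (λ j → w r g z (toℕ j)) ℤ.+ -1ℤ ℤ.* t) drop-last ⟨
  sum {suc m} (λ j → w r g z (toℕ j)) ℤ.+ -1ℤ ℤ.* sum {suc m} (λ j → w r g (z ℤ.- 1ℤ) (toℕ j))
    ≡⟨ cong (λ t → sum {suc m} (λ j → w r g z (toℕ j)) ℤ.+ t) (*-distribˡ-sum {suc m} -1ℤ (λ j → w r g (z ℤ.- 1ℤ) (toℕ j))) ⟩
  sum {suc m} (λ j → w r g z (toℕ j)) ℤ.+ sum {suc m} (λ j → -1ℤ ℤ.* w r g (z ℤ.- 1ℤ) (toℕ j))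
    ≡⟨ ∑-distrib-+ {suc m} (λ j → w r g z (toℕ j)) (λ j → -1ℤ ℤ.* w r g (z ℤ.- 1ℤ) (toℕ j)) ⟨
  sum {suc m} (λ j → w r g z (toℕ j) ℤ.+ -1ℤ ℤ.* w r g (z ℤ.- 1ℤ) (toℕ j))
    ≡⟨ sum-cong-≗ {suc m} (λ j → collect (-1ℤ ℤ.^ toℕ j ℤ.* + (r C toℕ j)) (toℕ j)) ⟩
  sum {suc m} (λ j → w r ∇g z (toℕ j))
    ≡⟨ alternating-sum r ∇-degree (suc m) z (ℕ.m<n⇒m<1+n r<m) ⟩
  0ℤ ∎
  where
  open ≡-Reasoning
  w = alternating
  -- Pascal's rule turns the sum of order r + 1 for g into the sum of order r for its backward
  -- difference, which has one degree less.
  ∇g : ℤ → ℤ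
  ∇g z = g (z ℤ.- 1ℤ ℤ.+ 1ℤ) ℤ.- g (z ℤ.- 1ℤ)
  ∇-degree : Degree< r ∇g
  ∇-degree = degree-shift {g = λ z → g (z ℤ.+ 1ℤ) ℤ.- g z} -1ℤ p
  nC0≡1 : ∀ n → n C 0 ≡ 1
  nC0≡1 n = trans (nCk≡nC[n∸k] {0} {n} ℕ.z≤n) (nCn≡1 n)
  first : w (suc r) g z 0 ≡ w r g z 0
  first = cong (λ t → 1ℤ ℤ.* + t ℤ.* g (z ℤ.- 0ℤ)) (trans (nC0≡1 (suc r)) (sym (nC0≡1 r)))
  pascal : ∀ j → w (suc r) g z (suc j) ≡ w r g z (suc j) ℤ.+ -1ℤ ℤ.* w r g (z ℤ.- 1ℤ) j
  pascal j = trans (cong (λ t → -1ℤ ℤ.* -1ℤ ℤ.^ j ℤ.* + t ℤ.* g (z ℤ.- + suc j)) (sym (nCk+nC[k+1]≡[n+1]C[k+1] r j)))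
    (trans (distribute (-1ℤ ℤ.^ j) (+ (r C j)) (+ (r C suc j)) (g (z ℤ.- + suc j)))
      (cong (λ t → w r g z (suc j) ℤ.+ -1ℤ ℤ.* (-1ℤ ℤ.^ j ℤ.* + (r C j) ℤ.* g t)) (shift z (+ j))))
    where
    distribute : ∀ s a b u → -1ℤ ℤ.* s ℤ.* (a ℤ.+ b) ℤ.* u ≡ -1ℤ ℤ.* s ℤ.* b ℤ.* u ℤ.+ -1ℤ ℤ.* (s ℤ.* a ℤ.* u)
    distribute = solve-∀
    shift : ∀ z j → z ℤ.- (1ℤ ℤ.+ j) ≡ z ℤ.- 1ℤ ℤ.- j
    shift = solve-∀
  -- Both sums need the same range; the added term contains C(r, m), which is 0 because r < m.
  drop-last : sum {suc m} (λ j → w r g (z ℤ.- 1ℤ) (toℕ j)) ≡ sum {m} (λ j → w r g (z ℤ.- 1ℤ) (toℕ j))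
  drop-last = trans (sum-init-last {m} (λ j → w r g (z ℤ.- 1ℤ) (toℕ j)))
    (trans (cong₂ ℤ._+_ (sum-cong-≗ {m} λ j → cong (w r g (z ℤ.- 1ℤ)) (Fin.toℕ-inject₁ j)) last-zero) (ℤ.+-identityʳ _))
    where
    last-zero : w r g (z ℤ.- 1ℤ) (toℕ (fromℕ m)) ≡ 0ℤ
    last-zero = trans (cong (w r g (z ℤ.- 1ℤ)) (Fin.toℕ-fromℕ m))
      (trans (cong (λ t → -1ℤ ℤ.^ m ℤ.* + t ℤ.* g (z ℤ.- 1ℤ ℤ.- + m)) (k>n⇒nCk≡0 r<m)) (annihilate (-1ℤ ℤ.^ m) (g (z ℤ.- 1ℤ ℤ.- + m))))
      where
      annihilate : ∀ s u → s ℤ.* 0ℤ ℤ.* u ≡ 0ℤ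
      annihilate = solve-∀
  collect : ∀ s j → s ℤ.* g (z ℤ.- + j) ℤ.+ -1ℤ ℤ.* (s ℤ.* g (z ℤ.- 1ℤ ℤ.- + j)) ≡ s ℤ.* ∇g (z ℤ.- + j)
  collect s j = trans (factor s (g (z ℤ.- + j)) (g (z ℤ.- 1ℤ ℤ.- + j)))
    (cong₂ (λ p q → s ℤ.* (g p ℤ.- g q)) (unshift z (+ j)) (swap z (+ j)))
    where
    factor : ∀ s u v → s ℤ.* u ℤ.+ -1ℤ ℤ.* (s ℤ.* v) ≡ s ℤ.* (u ℤ.- v)
    factor = solve-∀
    unshift : ∀ z j → z ℤ.- j ≡ z ℤ.- j ℤ.- 1ℤ ℤ.+ 1ℤ
    unshift = solve-∀
    swap : ∀ z j → z ℤ.- 1ℤ ℤ.- j ≡ z ℤ.- j ℤ.- 1ℤ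
    swap = solve-∀

sum-halves : ∀ N (w t : ℕ → ℤ) → (∀ {m} → m ℕ.≤ N → w (N ∸ m) ≡ t m) → (∀ {m} → m ℕ.≤ N → w (suc N + m) ≡ t m) →
             sum {suc N + suc N} (λ j → w (toℕ j)) ≡ sum {suc N} (λ m → t (toℕ m)) ℤ.+ sum {suc N} (λ m → t (toℕ m))
sum-halves N w t left right = begin
  sum {suc N + suc N} (λ j → w (toℕ j))
    ≡⟨ sum-++ (suc N) {suc N} (λ j → w (toℕ j)) ⟩
  sum {suc N} (λ j → w (toℕ (j ↑ˡ suc N))) ℤ.+ sum {suc N} (λ i → w (toℕ (suc N ↑ʳ i)))
    ≡⟨ cong₂ ℤ._+_ (sum-permute {suc N} {suc N} (λ j → w (toℕ (j ↑ˡ suc N))) reverse)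
                   (sum-cong-≗ {suc N} λ i → trans (cong w (Fin.toℕ-↑ʳ (suc N) i)) (right (ℕ.s≤s⁻¹ (Fin.toℕ<n i)))) ⟩
  sum {suc N} (λ j → w (toℕ (opposite j ↑ˡ suc N))) ℤ.+ sum {suc N} (λ m → t (toℕ m))
    ≡⟨ cong (ℤ._+ sum {suc N} (λ m → t (toℕ m)))
         (sum-cong-≗ {suc N} λ j → trans (cong w (trans (Fin.toℕ-↑ˡ (opposite j) (suc N)) (Fin.opposite-prop j))) (left (ℕ.s≤s⁻¹ (Fin.toℕ<n j)))) ⟩
  sum {suc N} (λ m → t (toℕ m)) ℤ.+ sum {suc N} (λ m → t (toℕ m)) ∎
  where open ≡-Reasoning

-- The arguments N - j run from N down to -N-1. Reflection in -1/2 preserves the binomials, reverses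
-- the alternating sign because the order 2N + 1 is odd, and negates f, so it preserves every term.
half-sum : ∀ N (f : ℤ → ℤ) → Degree< (suc (N + N)) f → (∀ i → f -[1+ i ] ≡ ℤ.- f (+ i)) →
           sum {suc N} (λ m → -1ℤ ℤ.^ (N + toℕ m) ℤ.* + (suc (N + N) C (N ∸ toℕ m)) ℤ.* f (+ toℕ m)) ≡ 0ℤ
half-sum N f deg odd = double-zero (trans (sym (sum-halves N w term left right))
  (alternating-sum R deg (suc N + suc N) (+ N) (ℕ.≤-reflexive (cong suc (sym (ℕ.+-suc N N))))))
  where
  open ≡-Reasoning
  R = suc (N + N)
  w : ℕ → ℤ
  w = alternating R f (+ N)
  term : ℕ → ℤ
  term m = -1ℤ ℤ.^ (N + m) ℤ.* + (R C (N ∸ m)) ℤ.* f (+ m)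

  double-zero : ∀ {u} → u ℤ.+ u ≡ 0ℤ → u ≡ 0ℤ
  double-zero {+ zero}   _ = refl
  double-zero {+ suc _}  ()
  double-zero { -[1+ _ ]} ()

  sign-even : ∀ a m → -1ℤ ℤ.^ a ≡ -1ℤ ℤ.^ (a + m + m)
  sign-even a zero    = cong (-1ℤ ℤ.^_) (sym (trans (ℕ.+-identityʳ (a + 0)) (ℕ.+-identityʳ a)))
  sign-even a (suc m) = trans (sign-even a m) (trans (two (-1ℤ ℤ.^ (a + m + m)))
    (cong (-1ℤ ℤ.^_) (sym (trans (ℕ.+-suc (a + suc m) m) (cong (λ t → suc (t + m)) (ℕ.+-suc a m))))))
    where
    two : ∀ u → u ≡ -1ℤ ℤ.* (-1ℤ ℤ.* u)
    two = solve-∀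

  left : ∀ {m} → m ℕ.≤ N → w (N ∸ m) ≡ term m
  left {m} m≤N = cong₂ (λ s t → s ℤ.* + (R C (N ∸ m)) ℤ.* f t) sign point
    where
    sign : -1ℤ ℤ.^ (N ∸ m) ≡ -1ℤ ℤ.^ (N + m)
    sign = trans (sign-even (N ∸ m) m) (cong (λ t → -1ℤ ℤ.^ (t + m)) (ℕ.m∸n+n≡m m≤N))
    point : + N ℤ.- + (N ∸ m) ≡ + m
    point = trans (ℤ.m-n≡m⊖n N (N ∸ m)) (trans (ℤ.⊖-≥ (ℕ.m∸n≤m N m)) (cong +_ (ℕ.m∸[m∸n]≡n m≤N)))

  right : ∀ {m} → m ℕ.≤ N → w (suc N + m) ≡ term m
  right {m} m≤N = begin
    -1ℤ ℤ.^ suc (N + m) ℤ.* + (R C (suc N + m)) ℤ.* f (+ N ℤ.- + (suc N + m))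
      ≡⟨ cong₂ (λ s t → -1ℤ ℤ.^ suc (N + m) ℤ.* + s ℤ.* t) symmetric (trans (cong f point) (odd m)) ⟩
    -1ℤ ℤ.^ suc (N + m) ℤ.* + (R C (N ∸ m)) ℤ.* (ℤ.- f (+ m))
      ≡⟨ signs (-1ℤ ℤ.^ (N + m)) (+ (R C (N ∸ m))) (f (+ m)) ⟩
    term m ∎
    where
    symmetric : R C (suc N + m) ≡ R C (N ∸ m)
    symmetric = trans (nCk≡nC[n∸k] (ℕ.s≤s (ℕ.+-monoʳ-≤ N m≤N))) (cong (R C_) (ℕ.[m+n]∸[m+o]≡n∸o N N m))
    point : + N ℤ.- + (suc N + m) ≡ -[1+ m ]
    point = trans (ℤ.m-n≡m⊖n N (suc N + m)) (trans (ℤ.⊖-< (ℕ.s≤s (ℕ.m≤m+n N m)))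
      (cong (λ t → ℤ.- + t) (trans (cong (_∸ N) (sym (ℕ.+-suc N m))) (ℕ.m+n∸m≡n N (suc m)))))
    signs : ∀ s c u → -1ℤ ℤ.* s ℤ.* c ℤ.* (ℤ.- u) ≡ s ℤ.* c ℤ.* u
    signs = solve-∀

-- The counting polynomial and its reciprocity

module Reciprocity (d : ℕ) where

  private
    n = suc d
    D = d * d

  -- The counting polynomial as a sum over leaves. It is built from the exponents a; for balanced
  -- leaves the exponents b = D + 1 - a return under reflection.
  pieces : List (ℕ × ℕ) → ℤ → ℤ
  pieces []             z = 0ℤ
  pieces ((a , _) ∷ ls) z = risingBinomial D (z ℤ.- + a) ℤ.+ pieces ls z

  pieces-degree : ∀ ls → Degree< (suc D) (pieces ls)
  pieces-degree []             = degree-0 (suc D)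
  pieces-degree ((a , _) ∷ ls) =
    degree-+ (degree-shift (ℤ.- + a) (rising-degree D)) (pieces-degree ls)

  pieces-total : ∀ ls → All (λ l → proj₁ l ℕ.≤ D) ls → ∀ k → pieces ls (+ k) ≡ + total (suc D) (List.map proj₁ ls) k
  pieces-total []             []        k = refl
  pieces-total ((a , _) ∷ ls) (le ∷ les) k = cong₂ ℤ._+_
    (trans (cong (risingBinomial D) (ℤ.m-n≡m⊖n k a)) (sym (coeff-rising D a k (ℕ.≤-trans le (ℕ.m≤n+m D k)))))
    (pieces-total ls les k)

  -- Since a + b = D + 1, the point -(k+1) - a is the reflection of k+1 - b. Values at negative
  -- arguments are therefore counts with the exponents b, up to sign.
  pieces-reflect : ∀ ls → All (λ l → proj₁ l + proj₂ l ≡ suc D) ls → ∀ k →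
                   pieces ls -[1+ k ] ≡ -1ℤ ℤ.^ D ℤ.* + total (suc D) (List.map proj₂ ls) (suc k)
  pieces-reflect [] [] k = sym (ℤ.*-zeroʳ (-1ℤ ℤ.^ D))
  pieces-reflect ((a , b) ∷ ls) (eq ∷ eqs) k = trans
    (cong₂ ℤ._+_ head (pieces-reflect ls eqs k))
    (sym (ℤ.*-distribˡ-+ (-1ℤ ℤ.^ D) (+ coeff (suc D) b (suc k)) (+ total (suc D) (List.map proj₂ ls) (suc k))))
    where
    open ≡-Reasoning
    b≤ : b ℕ.≤ suc k + D
    b≤ = ℕ.≤-trans (ℕ.m≤n+m b a) (ℕ.≤-trans (ℕ.≤-reflexive eq) (ℕ.s≤s (ℕ.m≤n+m D k)))
    head : risingBinomial D (-[1+ k ] ℤ.- + a) ≡ -1ℤ ℤ.^ D ℤ.* + coeff (suc D) b (suc k)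
    head = begin
      risingBinomial D (-[1+ k ] ℤ.- + a)                     ≡⟨ cong (risingBinomial D) (rearrange (+ suc k) (+ a) (+ b)) ⟩
      risingBinomial D (ℤ.- (+ suc k ℤ.- + b) ℤ.- + (a + b))  ≡⟨ cong₂ (λ s t → risingBinomial D (ℤ.- s ℤ.- + t)) (ℤ.m-n≡m⊖n (suc k) b) eq ⟩
      risingBinomial D (ℤ.- (suc k ℤ.⊖ b) ℤ.- + suc D)        ≡⟨ rising-reflect D (suc k ℤ.⊖ b) ⟩
      -1ℤ ℤ.^ D ℤ.* risingBinomial D (suc k ℤ.⊖ b)            ≡⟨ cong (-1ℤ ℤ.^ D ℤ.*_) (coeff-rising D b (suc k) b≤) ⟨
      -1ℤ ℤ.^ D ℤ.* + coeff (suc D) b (suc k)                 ∎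
      where
      rearrange : ∀ k a b → ℤ.- k ℤ.- a ≡ ℤ.- (k ℤ.- b) ℤ.- (a ℤ.+ b)
      rearrange = solve-∀

  coeff-origin : ∀ m → coeff m 0 0 ≡ 1
  coeff-origin zero    = refl
  coeff-origin (suc m) = coeff-origin m

  -- No leaf has b = 0, since it would contribute 1 to the count at the origin.
  bounded : ∀ ls → All (λ l → proj₁ l + proj₂ l ≡ suc D) ls → total (suc D) (List.map proj₂ ls) 0 ≡ 0 →
            All (λ l → proj₁ l ℕ.≤ D) ls
  bounded [] [] _ = []
  bounded ((a , zero) ∷ ls) (eq ∷ eqs) z =
    contradiction (trans (sym (coeff-origin (suc D))) (ℕ.m+n≡0⇒m≡0 (coeff (suc D) 0 0) z)) λ ()
  bounded ((a , suc b) ∷ ls) (eq ∷ eqs) z =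
    ℕ.m+n≤o⇒m≤o a (ℕ.≤-reflexive (ℕ.suc-injective (trans (sym (ℕ.+-suc a b)) eq)))
    ∷ bounded ls eqs (ℕ.m+n≡0⇒n≡0 (coeff (suc D) (suc b) 0) z)

  reciprocity : ∃ λ (p : ℤ → ℤ) → Degree< (suc D) p × (∀ k → p (+ k) ≡ + H n k)
              × (∀ k → p (ℤ.- + (n + k)) ≡ -1ℤ ℤ.^ D ℤ.* + H n k)
  reciprocity = let (ls , balanced , closed , opened , origin) = MagicCone.hVector d in
    pieces ls , pieces-degree ls
    , (λ k → trans (pieces-total ls (bounded ls balanced origin) k) (cong +_ (sym (closed k))))
    -- The argument -(n + k) is `-[1+ d + k ]`, so the reflected count has degree n + k, the shift
    -- by the all-ones square.
    , (λ k → trans (pieces-reflect ls balanced (d + k)) (cong (λ t → -1ℤ ℤ.^ D ℤ.* + t) (sym (opened k))))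

-- Squares of even size

^-odd : ∀ m → -1ℤ ℤ.^ suc (m + m) ≡ -1ℤ
^-odd zero    = refl
^-odd (suc m) = trans (cong (λ t → -1ℤ ℤ.* (-1ℤ ℤ.* -1ℤ ℤ.^ t)) (ℕ.+-suc m m)) (trans (two (-1ℤ ℤ.^ suc (m + m))) (^-odd m))
  where
  two : ∀ u → -1ℤ ℤ.* (-1ℤ ℤ.* u) ≡ u
  two = solve-∀

module _ (d M : ℕ) (eq : d * d ≡ suc (M + M)) (p : ℤ → ℤ) (deg : Degree< (suc (d * d)) p)
         (natural : ∀ k → p (+ k) ≡ + H (suc d) k)
         (negative : ∀ k → p (ℤ.- + (suc d + k)) ≡ -1ℤ ℤ.^ (d * d) ℤ.* + H (suc d) k) where

  private
    N = suc M
    f : ℤ → ℤ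
    f z = p (+ suc d ℤ.* z)
    -- Here D = 2M + 1 and N = M + 1, so 2N + 1 is D + 2. `degree-suc` supplies the one order beyond
    -- D + 1 that makes it odd.
    f-degree : Degree< (suc (N + N)) f
    f-degree = degree-scale (suc (N + N)) (suc d) (subst (λ t → Degree< t p) (cong (λ t → suc (suc t)) (trans eq (sym (ℕ.+-suc M M))))
      (degree-suc deg))
    value : ∀ i → f (+ i) ≡ + H (suc d) (suc d * i)
    value i = trans (cong p (sym (ℤ.pos-* (suc d) i))) (natural (suc d * i))
    odd : ∀ i → f -[1+ i ] ≡ ℤ.- f (+ i)
    odd i = begin
      p (+ suc d ℤ.* -[1+ i ])                          ≡⟨ cong p (trans (sym (ℤ.neg-distribʳ-* (+ suc d) (+ suc i))) (cong ℤ.-_ (trans (sym (ℤ.pos-* (suc d) (suc i))) (cong +_ (ℕ.*-suc (suc d) i))))) ⟩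
      p (ℤ.- + (suc d + suc d * i))                     ≡⟨ negative (suc d * i) ⟩
      -1ℤ ℤ.^ (d * d) ℤ.* + H (suc d) (suc d * i)       ≡⟨ cong₂ (λ s t → s ℤ.* t) (trans (cong (-1ℤ ℤ.^_) eq) (^-odd M)) (sym (value i)) ⟩
      -1ℤ ℤ.* f (+ i)                                   ≡⟨ ℤ.-1*i≡-i (f (+ i)) ⟩
      ℤ.- f (+ i)                                       ∎
      where open ≡-Reasoning

  vanishing : sum {suc N} (λ m → -1ℤ ℤ.^ (N + toℕ m) ℤ.* + (suc (N + N) C (N ∸ toℕ m)) ℤ.* + H (suc d) (suc d * toℕ m)) ≡ 0ℤ
  vanishing = trans
    (sum-cong-≗ {suc N} λ m → cong (λ t → -1ℤ ℤ.^ (N + toℕ m) ℤ.* + (suc (N + N) C (N ∸ toℕ m)) ℤ.* t) (sym (value (toℕ m))))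
    (half-sum N f f-degree odd)

theorem6p6 : (d : ℕ) .{{_ : NonZero d}} → 2 ∣ d →
    let N = ⌈ (d ∸ 1) ^ 2 /2⌉ in
    ∑[ m ≤ N ] ((-1ℤ ℤ.^ (N + toℕ m)) ℤ.* (+ ((d ^ 2 ∸ 2 * d + 3) C (N ∸ toℕ m))) ℤ.* (+ H d (d * toℕ m))) ≡ 0ℤ
theorem6p6 .(suc h * 2) (divides (suc h) refl) =
  subst₂ (λ N R → sum {suc N} (λ m → -1ℤ ℤ.^ (N + toℕ m) ℤ.* + (R C (N ∸ toℕ m)) ℤ.* + H (suc d) (suc d * toℕ m)) ≡ 0ℤ)
    (sym half) (sym order) (let (p , deg , natural , negative) = Reciprocity.reciprocity d in vanishing d M square p deg natural negative)
  where
  -- One less than the size of the squares, hence odd; M is chosen so that its square is 2M + 1.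
  d = suc (h * 2)
  M = 2 * h * h + 2 * h
  square : d * d ≡ suc (M + M)
  square = expand h
    where
    expand : ∀ h → suc (h * 2) * suc (h * 2) ≡ suc ((2 * h * h + 2 * h) + (2 * h * h + 2 * h))
    expand = ℕSolver.solve-∀
  square′ : d ^ 2 ≡ suc (M + M)
  square′ = trans (cong (d *_) (ℕ.*-identityʳ d)) square
  half : ⌈ d ^ 2 /2⌉ ≡ suc M
  half = trans (cong ⌈_/2⌉ square′) (cong suc (sym (ℕ.n≡⌊n+n/2⌋ M)))
  order : suc d ^ 2 ∸ 2 * suc d + 3 ≡ suc (suc M + suc M)
  order = trans (cong (λ t → t ∸ 2 * suc d + 3) expand) (trans (cong (_+ 3) (ℕ.m+n∸n≡m (M + M) (2 * suc d))) (finish M))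
    where
    -- The truncated subtraction is exact, as the square of d + 1 exceeds 2 (d + 1) by M + M.
    expand : suc d ^ 2 ≡ M + M + 2 * suc d
    expand = ℕ.suc-injective (trans (complete d) (cong (_+ 2 * suc d) square))
      where
      complete : ∀ d → suc (suc d * (suc d * 1)) ≡ d * d + 2 * suc d
      complete = ℕSolver.solve-∀
    finish : ∀ M → M + M + 3 ≡ suc (suc M + suc M)
    finish = ℕSolver.solve-∀
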